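{- Let $\mathrm{Pnest}_{\mathcal N_2(0)}(t)=1$ and $\mathrm{Pnest}^c_{\mathcal N_2(0)}(t)=0$. For $n\ge1$ let $\mathrm{Pnest}_{\mathcal N_2(n)}(t)=\sum t^{\mathrm{pnest}(\mathbf a)}$, the sum being over all area sequences $\mathbf a$ of size $n$ with $\mathrm{pnest}(\mathbf a)\le2$, and let $\mathrm{Pnest}^c_{\mathcal N_2(n)}(t)$ be the same sum restricted to those $\mathbf a$ for which $\Gamma_{\mathbf a}$ is connected. Then $\mathrm{Pnest}_{\mathcal N_2(n)}(t)$ and $\mathrm{Pnest}^c_{\mathcal N_2(n)}(t)$ are real-rooted for every $n\ge0$, and the sequences $\{\mathrm{Pnest}_{\mathcal N_2(n)}(t)\}_{n\ge0}$ and $\{\mathrm{Pnest}^c_{\mathcal N_2(n)}(t)\}_{n\ge0}$ are generalized Sturm sequences.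
   Context: Write $[n]=\{1,\dots,n\}$. An area sequence of size $n$ is a sequence $\mathbf a=(a_1,\dots,a_n)$ of nonnegative integers with $a_i<i$ for all $i$ and $a_i\le a_{i-1}+1$ for all $i\ge 2$. It defines a graph $\Gamma_{\mathbf a}$ (a unit interval graph) on $[n]$ with edges $\{j,i\}$ for $1\le j<i\le n$ with $i-a_i\le j$. If $\{i,j\}$ with $i<j$ is an edge then $\{i,i+1,\dots,j\}$ is a clique. A peak-edge of $\Gamma_{\mathbf a}$ is either an isolated vertex $i$ (put $j=i$) or an edge $\{i,j\}$, $i<j$, such that neither $\{i,j+1\}$ nor $\{i-1,j\}$ is an edge (pairs not contained in $[n]$ are not edges). The corresponding peak-clique is $\{i,\dots,j\}$. The peak-nesting of a vertex is the number of peak-cliques containing it, and $\mathrm{pnest}(\mathbf a)$ is the maximum over all vertices. ($\Gamma_{\mathbf a}$ is called $2$-nested if $\mathrm{pnest}(\mathbf a)\le2$.) A real polynomial is real-rooted if all its zeros are real (constants, including $0$, are real-rooted). For real-rooted $f,g$ with positive leading coefficients and zeros (with multiplicity) $\cdots\le\lambda_2\le\lambda_1$ and $\cdots\le\delta_2\le\delta_1$ respectively, write $g\ll f$ if $\cdots\le\delta_2\le\lambda_2\le\delta_1\le\lambda_1$ (so the degrees differ by at most one, $\deg g\le\deg f$); by convention also $0\ll0$, $0\ll f$, $f\ll0$. A sequence $\{f_i\}_{i\ge0}$ of real-rooted polynomials with positive leading coefficients (the zero polynomial being allowed under this convention) is a generalized Sturm sequence if $f_{i-1}\ll f_i$ for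 all $i\ge1$. -}

module Defs where

open import Data.Fin.Base as Fin using (Fin; toℕ; fromℕ<)
import Data.Fin.Properties as Fin
open import Data.List.Base
  using (List; []; _∷_; map; foldr; filter; length; replicate; upTo; allFin;
         cartesianProduct; cartesianProductWith; _++_)
open import Data.List.Extrema.Nat using (max)
open import Data.List.Relation.Unary.Linked using (Linked)
open import Data.Nat.Base as ℕ using (ℕ; zero; suc; _∸_)
import Data.Nat.Properties as ℕ
open import Data.Product.Base using (∃; _×_; _,_; proj₁; proj₂)
open import Data.Rational.Base as ℚ using (ℚ; 0ℚ; 1ℚ; ½; positive)
import Data.Rational.Properties as ℚ
open import Data.Rational.Solver using (module +-*-Solver)
open import Data.Sum.Base using (_⊎_; inj₁; inj₂)
open import Data.Vec.Base using (Vec; []; lookup; _∷ʳ_)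
open import Function.Base using (_∘_; flip)
open import Relation.Binary.Construct.Closure.ReflexiveTransitive
  using (Star; _◅_; _◅◅_; reverse)
  renaming (ε to stop)
open import Relation.Binary.PropositionalEquality
  using (_≡_; refl; sym; trans; cong; subst; subst₂)
open import Relation.Nullary using (¬_; Dec; yes; no; contradiction)
open import Relation.Nullary.Decidable using (map′; _×-dec_; _⊎-dec_; _→-dec_; ¬?)
open import Relation.Unary using (Decidable)

------------------------------------------------------------------------
-- Area sequences and unit interval graphs
--
-- The vertex i ∈ {1, …, n} is represented by the element of Fin n whose
-- value under toℕ is i − 1, and a_i is the entry at that position.

private
  variable
    n : ℕ

record IsAreaSequence (a : Vec ℕ n) : Set where
  constructor mkArea
  field
    bounded : ∀ i → lookup a i ℕ.< suc (toℕ i)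
    step    : ∀ i k → toℕ k ≡ suc (toℕ i) → lookup a k ℕ.≤ suc (lookup a i)

-- Edge a j i is only inhabited for j < i: the smaller endpoint comes first.

record Edge (a : Vec ℕ n) (j i : Fin n) : Set where
  constructor mkEdge
  field
    ordered : j Fin.< i
    inRange : toℕ i ∸ lookup a i ℕ.≤ toℕ j

Adjacent : Vec ℕ n → Fin n → Fin n → Set
Adjacent a i j = Edge a i j ⊎ Edge a j i

IsIsolated : Vec ℕ n → Fin n → Set
IsIsolated a i = ∀ j → ¬ Adjacent a i j

IsConnected : Vec ℕ n → Set
IsConnected a = ∀ i j → Star (Adjacent a) i j

-- In the second alternative k ranges over the vertices j + 1 (resp.
-- i − 1) that lie in the graph, so a pair leaving the vertex set is
-- vacuously not an edge.

IsPeakEdge : Vec ℕ n → Fin n → Fin n → Set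
IsPeakEdge a i j =
    (i ≡ j × IsIsolated a i)
  ⊎ ( Edge a i j
    × (∀ k → toℕ k ≡ suc (toℕ j) → ¬ Edge a i k)
    × (∀ k → suc (toℕ k) ≡ toℕ i → ¬ Edge a k j))

isAreaSequence? : Decidable (IsAreaSequence {n})
isAreaSequence? a =
  map′ (λ (b , s) → mkArea b s) (λ (mkArea b s) → b , s)
    (Fin.all? (λ i → lookup a i ℕ.<? suc (toℕ i))
    ×-dec
    Fin.all? (λ i → Fin.all? λ k →
      (toℕ k ℕ.≟ suc (toℕ i)) →-dec (lookup a k ℕ.≤? suc (lookup a i))))

edge? : ∀ (a : Vec ℕ n) i j → Dec (Edge a i j)
edge? a i j =
  map′ (λ (o , r) → mkEdge o r) (λ (mkEdge o r) → o , r)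
    ((i Fin.<? j) ×-dec (toℕ j ∸ lookup a j ℕ.≤? toℕ i))

isIsolated? : ∀ (a : Vec ℕ n) i → Dec (IsIsolated a i)
isIsolated? a i = Fin.all? λ j → ¬? (edge? a i j ⊎-dec edge? a j i)

isPeakEdge? : ∀ (a : Vec ℕ n) i j → Dec (IsPeakEdge a i j)
isPeakEdge? a i j =
    ((i Fin.≟ j) ×-dec isIsolated? a i)
  ⊎-dec
    ( edge? a i j
    ×-dec Fin.all? (λ k → (toℕ k ℕ.≟ suc (toℕ j)) →-dec ¬? (edge? a i k))
    ×-dec Fin.all? (λ k → (suc (toℕ k) ℕ.≟ toℕ i) →-dec ¬? (edge? a k j)))

-- A peak-clique {i, …, j} is represented by its peak-edge (i , j).

IsPeakCliqueAt : Vec ℕ n → Fin n → Fin n × Fin n → Set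
IsPeakCliqueAt a v (i , j) = IsPeakEdge a i j × i Fin.≤ v × v Fin.≤ j

isPeakCliqueAt? : ∀ (a : Vec ℕ n) v → Decidable (IsPeakCliqueAt a v)
isPeakCliqueAt? a v (i , j) =
  isPeakEdge? a i j ×-dec (i Fin.≤? v) ×-dec (v Fin.≤? j)

peakNesting : Vec ℕ n → Fin n → ℕ
peakNesting {n} a v =
  length (filter (isPeakCliqueAt? a v) (cartesianProduct (allFin n) (allFin n)))

pnest : Vec ℕ n → ℕ
pnest {n} a = max 0 (map (peakNesting a) (allFin n))

------------------------------------------------------------------------
-- Connectedness is decidable on area sequences: the graph is connected
-- iff any two consecutive vertices are adjacent.

ConsecutiveEdges : Vec ℕ n → Set
ConsecutiveEdges {n} a = ∀ (i k : Fin n) → toℕ k ≡ suc (toℕ i) → Edge a i k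

private
  swap : ∀ {a : Vec ℕ n} {i j} → Adjacent a i j → Adjacent a j i
  swap (inj₁ e) = inj₂ e
  swap (inj₂ e) = inj₁ e

  ascend : ∀ {a : Vec ℕ n} → ConsecutiveEdges a →
           ∀ d {i j} → toℕ j ≡ d ℕ.+ toℕ i → Star (Adjacent a) i j
  ascend ce zero    eq = subst (Star _ _) (sym (Fin.toℕ-injective eq)) stop
  ascend ce (suc d) {i} {j} eq =
    ascend ce d (Fin.toℕ-fromℕ< d+i<n)
      ◅◅ (inj₁ (ce (fromℕ< d+i<n) j (trans eq (cong suc (sym (Fin.toℕ-fromℕ< d+i<n))))) ◅ stop)
    where
    d+i<n : d ℕ.+ toℕ i ℕ.< _
    d+i<n = ℕ.<-trans (subst (d ℕ.+ toℕ i ℕ.<_) (sym eq) (ℕ.n<1+n _)) (Fin.toℕ<n j)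

  -- An edge from {1, …, i} to {i+1, …, n} forces the edge {i, i+1}.
  cross : ∀ {a : Vec ℕ n} → IsAreaSequence a → ∀ {i k} → toℕ k ≡ suc (toℕ i) →
          ∀ d {p q} → toℕ q ≡ d ℕ.+ toℕ k → p Fin.≤ i → Edge a p q → Edge a i k
  cross area k≡1+i zero {p} {q} q≡k p≤i (mkEdge _ e)
    with refl ← Fin.toℕ-injective q≡k =
    mkEdge (subst (_ ℕ.<_) (sym k≡1+i) (ℕ.n<1+n _)) (ℕ.≤-trans e p≤i)
  cross {n} {a} area {i} {k} k≡1+i (suc d) {p} {q} q≡ p≤i (mkEdge _ e) =
    cross area k≡1+i d q′≡ p≤i (mkEdge p<q′ e′)
    where
    d+k<n : d ℕ.+ toℕ k ℕ.< n
    d+k<n = ℕ.<-trans (subst (d ℕ.+ toℕ k ℕ.<_) (sym q≡) (ℕ.n<1+n _)) (Fin.toℕ<n q)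
    q′ : Fin n
    q′ = fromℕ< d+k<n
    q′≡ : toℕ q′ ≡ d ℕ.+ toℕ k
    q′≡ = Fin.toℕ-fromℕ< d+k<n
    q≡1+q′ : toℕ q ≡ suc (toℕ q′)
    q≡1+q′ = trans q≡ (cong suc (sym q′≡))
    p<q′ : p Fin.< q′
    p<q′ = ℕ.≤-trans (ℕ.s≤s p≤i)
             (subst₂ ℕ._≤_ k≡1+i (sym q′≡) (ℕ.m≤n+m (toℕ k) d))
    e′ : toℕ q′ ∸ lookup a q′ ℕ.≤ toℕ p
    e′ = ℕ.≤-trans
           (subst (λ m → toℕ q′ ∸ lookup a q′ ℕ.≤ m ∸ lookup a q) (sym q≡1+q′)
             (ℕ.∸-monoʳ-≤ (suc (toℕ q′)) (IsAreaSequence.step area q′ q q≡1+q′)))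
           e

  crossing : ∀ {a : Vec ℕ n} → IsAreaSequence a → ∀ {i k} → toℕ k ≡ suc (toℕ i) →
             ∀ {u w} → u Fin.≤ i → i Fin.< w → Star (Adjacent a) u w → Edge a i k
  crossing area k≡ u≤i i<w stop = contradiction u≤i (ℕ.<⇒≱ i<w)
  crossing area {i} {k} k≡ u≤i i<w (_◅_ {j = v} s ss) with v Fin.≤? i
  ... | yes v≤i = crossing area k≡ v≤i i<w ss
  ... | no  v≰i with s
  ...   | inj₁ e = cross area k≡ (toℕ v ∸ toℕ k)
                     (sym (ℕ.m∸n+n≡m (subst (ℕ._≤ toℕ v) (sym k≡) (ℕ.≰⇒> v≰i)))) u≤i e
  ...   | inj₂ (mkEdge v<u _) = contradiction (ℕ.≤-trans (ℕ.<⇒≤ v<u) u≤i) v≰i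

consecutive⇒connected : ∀ {a : Vec ℕ n} → ConsecutiveEdges a → IsConnected a
consecutive⇒connected ce i j with ℕ.≤-total (toℕ i) (toℕ j)
... | inj₁ i≤j = ascend ce _ (sym (ℕ.m∸n+n≡m i≤j))
... | inj₂ j≤i = reverse swap (ascend ce _ (sym (ℕ.m∸n+n≡m j≤i)))

connected⇒consecutive : ∀ {a : Vec ℕ n} → IsAreaSequence a →
                        IsConnected a → ConsecutiveEdges a
connected⇒consecutive area c i k k≡ =
  crossing area k≡ ℕ.≤-refl (subst (toℕ i ℕ.<_) (sym k≡) (ℕ.n<1+n _)) (c i k)

isConnected? : ∀ (a : Vec ℕ n) → IsAreaSequence a → Dec (IsConnected a)
isConnected? a area =
  map′ consecutive⇒connected (connected⇒consecutive area)
    (Fin.all? λ i → Fin.all? λ k →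
      (toℕ k ℕ.≟ suc (toℕ i)) →-dec edge? a i k)

------------------------------------------------------------------------
-- The sets over which the generating polynomials are summed

-- All sequences with 0 ≤ a_i < i, each listed exactly once.

boundedSequences : ∀ n → List (Vec ℕ n)
boundedSequences zero    = [] ∷ []
boundedSequences (suc n) =
  cartesianProductWith _∷ʳ_ (boundedSequences n) (upTo (suc n))

Is2Nested : Vec ℕ n → Set
Is2Nested a = IsAreaSequence a × pnest a ℕ.≤ 2

IsConnected2Nested : Vec ℕ n → Set
IsConnected2Nested a = Is2Nested a × IsConnected a

is2Nested? : Decidable (Is2Nested {n})
is2Nested? a = isAreaSequence? a ×-dec (pnest a ℕ.≤? 2)

isConnected2Nested? : Decidable (IsConnected2Nested {n})
isConnected2Nested? a with is2Nested? a
... | no ¬p = no (¬p ∘ proj₁)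
... | yes p = map′ (p ,_) proj₂ (isConnected? a (proj₁ p))

𝒩₂ : ∀ n → List (Vec ℕ n)
𝒩₂ n = filter is2Nested? (boundedSequences n)

𝒩₂ᶜ : ∀ n → List (Vec ℕ n)
𝒩₂ᶜ n = filter isConnected2Nested? (boundedSequences n)

------------------------------------------------------------------------
-- Real numbers: Cauchy sequences of rationals with a modulus of
-- convergence, with _≈ℝ_ as equality and termwise operations

record ℝ : Set where
  constructor mkℝ
  field
    seq    : ℕ → ℚ
    cauchy : ∀ ε → 0ℚ ℚ.< ε → ∃ λ N → ∀ m n → N ℕ.≤ m → N ℕ.≤ n →
             ℚ.∣ seq m ℚ.- seq n ∣ ℚ.< ε

open ℝ public

infix  4 _≈ℝ_ _≤ℝ_ _<ℝ_
infix  8 -ℝ_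
infixl 7 _*ℝ_
infixl 6 _+ℝ_ _-ℝ_

_≈ℝ_ : ℝ → ℝ → Set
x ≈ℝ y = ∀ ε → 0ℚ ℚ.< ε → ∃ λ N → ∀ n → N ℕ.≤ n →
         ℚ.∣ seq x n ℚ.- seq y n ∣ ℚ.< ε

_≤ℝ_ : ℝ → ℝ → Set
x ≤ℝ y = ∀ ε → 0ℚ ℚ.< ε → ∃ λ N → ∀ n → N ℕ.≤ n →
         seq x n ℚ.≤ seq y n ℚ.+ ε

_<ℝ_ : ℝ → ℝ → Set
x <ℝ y = ∃ λ ε → 0ℚ ℚ.< ε × ∃ λ N → ∀ n → N ℕ.≤ n →
         seq x n ℚ.+ ε ℚ.≤ seq y n

_≥ℝ_ : ℝ → ℝ → Set
_≥ℝ_ = flip _≤ℝ_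

fromℚ : ℚ → ℝ
fromℚ q = mkℝ (λ _ → q) λ ε 0<ε → 0 , λ _ _ _ _ →
  subst (λ z → ℚ.∣ z ∣ ℚ.< ε) (sym (ℚ.+-inverseʳ q)) 0<ε

0ℝ 1ℝ : ℝ
0ℝ = fromℚ 0ℚ
1ℝ = fromℚ 1ℚ

private
  open +-*-Solver using (solve; _:=_; _:+_; _:*_; :-_; _:-_)

  p-q+q≡p : ∀ p q → p ℚ.- q ℚ.+ q ≡ p
  p-q+q≡p = solve 2 (λ p q → p :- q :+ q := p) refl

  +-difference : ∀ a b c d →
                 (a ℚ.- b) ℚ.+ (c ℚ.- d) ≡ (a ℚ.+ c) ℚ.- (b ℚ.+ d)
  +-difference =
    solve 4 (λ a b c d → (a :- b) :+ (c :- d) := (a :+ c) :- (b :+ d)) refl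

  neg-difference : ∀ a b → b ℚ.- a ≡ (ℚ.- a) ℚ.- (ℚ.- b)
  neg-difference = solve 2 (λ a b → b :- a := (:- a) :- (:- b)) refl

  *-difference : ∀ a b c d →
                 a ℚ.* (b ℚ.- d) ℚ.+ d ℚ.* (a ℚ.- c) ≡ a ℚ.* b ℚ.- c ℚ.* d
  *-difference =
    solve 4 (λ a b c d → a :* (b :- d) :+ d :* (a :- c) := a :* b :- c :* d) refl

  half-pos : ∀ ε → 0ℚ ℚ.< ε → 0ℚ ℚ.< ½ ℚ.* ε
  half-pos ε 0<ε = ℚ.*-monoʳ-<-pos ½ 0<ε

  half+half : ∀ ε → ½ ℚ.* ε ℚ.+ ½ ℚ.* ε ≡ ε
  half+half ε = trans (sym (ℚ.*-distribʳ-+ ε ½ ½)) (ℚ.*-identityˡ ε)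

  ∣∣-sum : ∀ p q {δ ε} → ℚ.∣ p ∣ ℚ.< δ → ℚ.∣ q ∣ ℚ.< ε → ℚ.∣ p ℚ.+ q ∣ ℚ.< δ ℚ.+ ε
  ∣∣-sum p q p< q< = ℚ.≤-<-trans (ℚ.∣p+q∣≤∣p∣+∣q∣ p q) (ℚ.+-mono-< p< q<)

  eventualBound : ∀ x → ∃ λ B → 0ℚ ℚ.< B × ∃ λ N → ∀ n → N ℕ.≤ n → ℚ.∣ seq x n ∣ ℚ.< B
  eventualBound x with cauchy x 1ℚ (ℚ.positive⁻¹ 1ℚ)
  ... | N , close =
      1ℚ ℚ.+ ℚ.∣ seq x N ∣
    , ℚ.+-mono-<-≤ (ℚ.positive⁻¹ 1ℚ) (ℚ.0≤∣p∣ (seq x N))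
    , N , λ n N≤n →
        subst (λ z → ℚ.∣ z ∣ ℚ.< 1ℚ ℚ.+ ℚ.∣ seq x N ∣)
          (p-q+q≡p (seq x n) (seq x N))
          (ℚ.≤-<-trans (ℚ.∣p+q∣≤∣p∣+∣q∣ (seq x n ℚ.- seq x N) (seq x N))
            (ℚ.+-mono-<-≤ (close n N N≤n ℕ.≤-refl) ℚ.≤-refl))

  *-bound : ∀ p q {B δ} → 0ℚ ℚ.< δ → ℚ.∣ p ∣ ℚ.< B → ℚ.∣ q ∣ ℚ.< δ →
            ℚ.∣ p ℚ.* q ∣ ℚ.≤ B ℚ.* δ
  *-bound p q {B} {δ} 0<δ p<B q<δ =
    subst (ℚ._≤ B ℚ.* δ) (sym (ℚ.∣p*q∣≡∣p∣*∣q∣ p q))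
      (ℚ.≤-trans
        (ℚ.*-monoˡ-≤-nonNeg ℚ.∣ p ∣ ⦃ ℚ.∣-∣-nonNeg p ⦄ (ℚ.<⇒≤ q<δ))
        (ℚ.*-monoʳ-≤-nonNeg δ ⦃ ℚ.nonNegative (ℚ.<⇒≤ 0<δ) ⦄ (ℚ.<⇒≤ p<B)))

  divide : ∀ ε B → 0ℚ ℚ.< ε → 0ℚ ℚ.< B → ∃ λ δ → 0ℚ ℚ.< δ × B ℚ.* δ ≡ ε
  divide ε B 0<ε 0<B = 1/B ℚ.* ε , pos , eq
    where
    instance
      B⁺ : ℚ.Positive B
      B⁺ = positive 0<B
      B≠0 : ℚ.NonZero B
      B≠0 = ℚ.pos⇒nonZero B
    1/B : ℚ
    1/B = ℚ.1/ B
    pos : 0ℚ ℚ.< 1/B ℚ.* ε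
    pos = subst (ℚ._< 1/B ℚ.* ε) (ℚ.*-zeroʳ 1/B)
            (ℚ.*-monoʳ-<-pos 1/B ⦃ ℚ.1/pos⇒pos B ⦄ 0<ε)
    eq : B ℚ.* (1/B ℚ.* ε) ≡ ε
    eq = trans (sym (ℚ.*-assoc B 1/B ε))
           (trans (cong (ℚ._* ε) (ℚ.*-inverseʳ B)) (ℚ.*-identityˡ ε))

_+ℝ_ : ℝ → ℝ → ℝ
x +ℝ y = mkℝ (λ n → seq x n ℚ.+ seq y n) λ ε 0<ε →
  let N , closeˣ = cauchy x (½ ℚ.* ε) (half-pos ε 0<ε)
      M , closeʸ = cauchy y (½ ℚ.* ε) (half-pos ε 0<ε)
  in N ℕ.⊔ M , λ m n N⊔M≤m N⊔M≤n →
     subst₂ (λ z δ → ℚ.∣ z ∣ ℚ.< δ)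
       (+-difference (seq x m) (seq x n) (seq y m) (seq y n))
       (half+half ε)
       (∣∣-sum (seq x m ℚ.- seq x n) (seq y m ℚ.- seq y n)
         (closeˣ m n (ℕ.m⊔n≤o⇒m≤o N M N⊔M≤m) (ℕ.m⊔n≤o⇒m≤o N M N⊔M≤n))
         (closeʸ m n (ℕ.m⊔n≤o⇒n≤o N M N⊔M≤m) (ℕ.m⊔n≤o⇒n≤o N M N⊔M≤n)))

-ℝ_ : ℝ → ℝ
-ℝ x = mkℝ (λ n → ℚ.- seq x n) λ ε 0<ε →
  let N , close = cauchy x ε 0<ε
  in N , λ m n N≤m N≤n →
     subst (λ z → ℚ.∣ z ∣ ℚ.< ε)
       (neg-difference (seq x m) (seq x n))
       (close n m N≤n N≤m)

_-ℝ_ : ℝ → ℝ → ℝ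
x -ℝ y = x +ℝ (-ℝ y)

private
  *-close : ∀ a b c d B C δ → 0ℚ ℚ.< δ → ℚ.∣ a ∣ ℚ.< B → ℚ.∣ d ∣ ℚ.< C →
            ℚ.∣ a ℚ.- c ∣ ℚ.< δ → ℚ.∣ b ℚ.- d ∣ ℚ.< δ →
            ℚ.∣ a ℚ.* b ℚ.- c ℚ.* d ∣ ℚ.≤ (B ℚ.+ C) ℚ.* δ
  *-close a b c d B C δ 0<δ a<B d<C a-c<δ b-d<δ = begin
    ℚ.∣ a ℚ.* b ℚ.- c ℚ.* d ∣
      ≡⟨ cong ℚ.∣_∣ (*-difference a b c d) ⟨
    ℚ.∣ a ℚ.* (b ℚ.- d) ℚ.+ d ℚ.* (a ℚ.- c) ∣
      ≤⟨ ℚ.∣p+q∣≤∣p∣+∣q∣ (a ℚ.* (b ℚ.- d)) (d ℚ.* (a ℚ.- c)) ⟩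
    ℚ.∣ a ℚ.* (b ℚ.- d) ∣ ℚ.+ ℚ.∣ d ℚ.* (a ℚ.- c) ∣
      ≤⟨ ℚ.+-mono-≤ (*-bound a (b ℚ.- d) 0<δ a<B b-d<δ)
                    (*-bound d (a ℚ.- c) 0<δ d<C a-c<δ) ⟩
    B ℚ.* δ ℚ.+ C ℚ.* δ
      ≡⟨ ℚ.*-distribʳ-+ δ B C ⟨
    (B ℚ.+ C) ℚ.* δ ∎
    where open ℚ.≤-Reasoning

  half<self : ∀ ε → 0ℚ ℚ.< ε → ½ ℚ.* ε ℚ.< ε
  half<self ε 0<ε =
    subst₂ ℚ._<_ (ℚ.+-identityˡ (½ ℚ.* ε)) (half+half ε)
      (ℚ.+-monoˡ-< (½ ℚ.* ε) (half-pos ε 0<ε))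

  *-cauchy : ∀ x y ε → 0ℚ ℚ.< ε → ∃ λ N → ∀ m n → N ℕ.≤ m → N ℕ.≤ n →
             ℚ.∣ seq x m ℚ.* seq y m ℚ.- seq x n ℚ.* seq y n ∣ ℚ.< ε
  *-cauchy x y ε 0<ε =
    let B , 0<B , N₁ , x<B = eventualBound x
        C , 0<C , N₂ , y<C = eventualBound y
        δ , 0<δ , [B+C]δ≡½ε = divide (½ ℚ.* ε) (B ℚ.+ C) (half-pos ε 0<ε)
                                (ℚ.+-mono-< 0<B 0<C)
        N₃ , closeˣ = cauchy x δ 0<δ
        N₄ , closeʸ = cauchy y δ 0<δ
        M = N₁ ℕ.⊔ N₂
        L = N₃ ℕ.⊔ N₄
    in M ℕ.⊔ L , λ m n ≤m ≤n →
      let M≤m = ℕ.m⊔n≤o⇒m≤o M L ≤m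
          M≤n = ℕ.m⊔n≤o⇒m≤o M L ≤n
          L≤m = ℕ.m⊔n≤o⇒n≤o M L ≤m
          L≤n = ℕ.m⊔n≤o⇒n≤o M L ≤n
      in ℚ.≤-<-trans
           (subst (ℚ.∣ seq x m ℚ.* seq y m ℚ.- seq x n ℚ.* seq y n ∣ ℚ.≤_) [B+C]δ≡½ε
             (*-close (seq x m) (seq y m) (seq x n) (seq y n) B C δ 0<δ
               (x<B m (ℕ.m⊔n≤o⇒m≤o N₁ N₂ M≤m))
               (y<C n (ℕ.m⊔n≤o⇒n≤o N₁ N₂ M≤n))
               (closeˣ m n (ℕ.m⊔n≤o⇒m≤o N₃ N₄ L≤m) (ℕ.m⊔n≤o⇒m≤o N₃ N₄ L≤n))
               (closeʸ m n (ℕ.m⊔n≤o⇒n≤o N₃ N₄ L≤m) (ℕ.m⊔n≤o⇒n≤o N₃ N₄ L≤n))))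
           (half<self ε 0<ε)

_*ℝ_ : ℝ → ℝ → ℝ
x *ℝ y = mkℝ (λ n → seq x n ℚ.* seq y n) (*-cauchy x y)

------------------------------------------------------------------------
-- Complex numbers

record ℂ : Set where
  constructor _+i_
  field
    re im : ℝ

open ℂ public

infix  4 _≈ℂ_
infixl 7 _*ℂ_
infixl 6 _+ℂ_

_≈ℂ_ : ℂ → ℂ → Set
z ≈ℂ w = re z ≈ℝ re w × im z ≈ℝ im w

fromℝ : ℝ → ℂ
fromℝ x = x +i 0ℝ

_+ℂ_ : ℂ → ℂ → ℂ
z +ℂ w = (re z +ℝ re w) +i (im z +ℝ im w)

_*ℂ_ : ℂ → ℂ → ℂ
z *ℂ w = (re z *ℝ re w -ℝ im z *ℝ im w) +i (re z *ℝ im w +ℝ im z *ℝ re w)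

------------------------------------------------------------------------
-- Real polynomials: lists of coefficients, constant term first, trailing
-- zeros allowed; equality _≈ₚ_ is coefficientwise

Poly : Set
Poly = List ℝ

coeff : Poly → ℕ → ℝ
coeff []      _       = 0ℝ
coeff (c ∷ p) zero    = c
coeff (c ∷ p) (suc k) = coeff p k

infix  4 _≈ₚ_
infixl 6 _+ₚ_
infixl 7 _*ₚ_ _·ₚ_

_≈ₚ_ : Poly → Poly → Set
p ≈ₚ q = ∀ k → coeff p k ≈ℝ coeff q k

0ₚ 1ₚ : Poly
0ₚ = []
1ₚ = 1ℝ ∷ []

_+ₚ_ : Poly → Poly → Poly
[]      +ₚ q       = q
(c ∷ p) +ₚ []      = c ∷ p
(c ∷ p) +ₚ (d ∷ q) = (c +ℝ d) ∷ (p +ₚ q)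

_·ₚ_ : ℝ → Poly → Poly
c ·ₚ p = map (c *ℝ_) p

_*ₚ_ : Poly → Poly → Poly
[]      *ₚ q = 0ₚ
(c ∷ p) *ₚ q = (c ·ₚ q) +ₚ (0ℝ ∷ (p *ₚ q))

t^_ : ℕ → Poly
t^ k = replicate k 0ℝ ++ 1ₚ

sumₚ : List Poly → Poly
sumₚ = foldr _+ₚ_ 0ₚ

evalℂ : Poly → ℂ → ℂ
evalℂ []      z = fromℝ 0ℝ
evalℂ (c ∷ p) z = fromℝ c +ℂ z *ℂ evalℂ p z

IsConstant : Poly → Set
IsConstant p = ∀ k → 0 ℕ.< k → coeff p k ≈ℝ 0ℝ

IsRealRooted : Poly → Set
IsRealRooted p =
  IsConstant p ⊎ (∀ z → evalℂ p z ≈ℂ fromℝ 0ℝ → im z ≈ℝ 0ℝ)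

HasPositiveLeadingCoeff : Poly → Set
HasPositiveLeadingCoeff p =
  ∃ λ d → 0ℝ <ℝ coeff p d × (∀ k → d ℕ.< k → coeff p k ≈ℝ 0ℝ)

-- λs lists the zeros of p with multiplicity, p having leading
-- coefficient c > 0.

HasZeros : Poly → List ℝ → Set
HasZeros p λs =
  ∃ λ c → 0ℝ <ℝ c × p ≈ₚ c ·ₚ foldr (λ r q → ((-ℝ r) ∷ 1ℝ ∷ []) *ₚ q) 1ₚ λs

interleave : List ℝ → List ℝ → List ℝ
interleave []       ys = ys
interleave (x ∷ xs) ys = x ∷ interleave ys xs

-- With λs = λ₁, λ₂, … and δs = δ₁, δ₂, … the interleaved list is
-- λ₁, δ₁, λ₂, δ₂, …; its being weakly decreasing also forces λs and δs
-- to be sorted.  The length conditions make the alternation exhaust both.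

Interlace : List ℝ → List ℝ → Set
Interlace δs λs =
    length δs ℕ.≤ length λs
  × length λs ℕ.≤ suc (length δs)
  × Linked _≥ℝ_ (interleave λs δs)

infix 4 _≪_

-- Meant for real-rooted g and f that are 0 or have positive leading
-- coefficients.

_≪_ : Poly → Poly → Set
g ≪ f =
    g ≈ₚ 0ₚ
  ⊎ f ≈ₚ 0ₚ
  ⊎ (∃ λ δs → ∃ λ λs → HasZeros g δs × HasZeros f λs × Interlace δs λs)

IsGeneralizedSturm : (ℕ → Poly) → Set
IsGeneralizedSturm f =
    (∀ i → IsRealRooted (f i) × (f i ≈ₚ 0ₚ ⊎ HasPositiveLeadingCoeff (f i)))
  × (∀ i → f i ≪ f (suc i))

------------------------------------------------------------------------
-- The generating polynomials

Pnest𝒩₂ : ℕ → Poly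
Pnest𝒩₂ zero      = 1ₚ
Pnest𝒩₂ n@(suc _) = sumₚ (map (λ a → t^ (pnest a)) (𝒩₂ n))

Pnestᶜ𝒩₂ : ℕ → Poly
Pnestᶜ𝒩₂ zero      = 0ₚ
Pnestᶜ𝒩₂ n@(suc _) = sumₚ (map (λ a → t^ (pnest a)) (𝒩₂ᶜ n))

{-# OPTIONS --safe #-}
module Submission where

-- Every non-empty area sequence has peak-nesting at least 1, so for n ≥ 1 each
-- polynomial is αₙ t + βₙ t², with zeros 0 and − αₙ / βₙ, and only
-- αₙ₊₁ βₙ ≤ αₙ βₙ₊₁ has to be shown.  Appending an entry x to a sequence with last
-- entry y preserves the peak-nesting if x = 0 (a new isolated vertex) or x = y + 1
-- (the last peak-clique grows), and for 0 < x ≤ y creates two peak-cliques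
-- that overlap.  Hence αₙ₊₁ = m αₙ and βₙ₊₁ ≥ m βₙ, where m = 2 in general
-- and m = 1 in the connected case, which excludes x = 0.

open import Defs
open import Algebra.Bundles using (CommutativeRing)
open import Data.Fin.Base as Fin using (Fin; toℕ; fromℕ; fromℕ<; inject₁)
import Data.Fin.Properties as Fin
open import Data.Fin.Relation.Unary.Top using (View; view; ‵fromℕ; ‵inject₁)
open import Data.List.Base
  using (List; []; _∷_; _++_; foldr; map; filter; length; allFin; cartesianProduct)
import Data.List.Extrema.Nat as Extrema
open import Data.List.Membership.Propositional using (_∈_)
import Data.List.Membership.Propositional.Properties as ∈
open import Data.List.Properties
  using (length-++; length-map; filter-accept; filter-reject; filter-none)
open import Data.List.Relation.Unary.All as All using (All; []; _∷_)
import Data.List.Relation.Unary.All.Properties as All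
open import Data.List.Relation.Unary.AllPairs using ([]; _∷_)
open import Data.List.Relation.Unary.Any using (here; there)
open import Data.List.Relation.Unary.Linked using ([-]; _∷_)
open import Data.List.Relation.Unary.Unique.Propositional using (Unique)
import Data.List.Relation.Unary.Unique.Propositional.Properties as Unique
open import Data.Nat.Base as ℕ using (ℕ; zero; suc; _∸_; _≤_; _<_; z≤n; s≤s)
import Data.Nat.Properties as ℕ
open import Data.Product.Base using (∃; _×_; _,_; proj₁; proj₂)
open import Data.Rational.Base as ℚ using (ℚ; 0ℚ; 1ℚ; ½)
import Data.Rational.Properties as ℚ
open import Data.Rational.Solver using (module +-*-Solver)
open import Data.Sum.Base using (_⊎_; inj₁; inj₂)
open import Data.Vec.Base using (Vec; []; _∷_; lookup; _∷ʳ_; initLast)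
import Data.Vec.Properties as Vec
open import Function.Base using (_∘_)
open import Relation.Binary.PropositionalEquality
open import Relation.Nullary using (Dec; yes; no; contradiction)
open import Relation.Nullary.Decidable using (_×-dec_; _→-dec_)
open import Relation.Unary using (Decidable)

open import Algebra.Properties.Semiring.Mult (CommutativeRing.semiring ℚ.+-*-commutativeRing)
  using (×1-homo-*) renaming (_×_ to _·_)
open +-*-Solver using (solve; con; _:=_; _:+_; _:*_; :-_; _:-_)

-- Counting by injections

-- The definition counts pairs (i , j), but in an area sequence the left end of a peak-clique with
-- largest vertex j is forced to be j - a_j, and j is such a largest vertex exactly when the next
-- entry, if there is one, is not larger than a_j. Counting these j makes the effect of an appended
-- entry local: only the old last vertex, for which the condition was vacuous, can change its
-- status. Nesting 1 arises from no entries but the two preserving ones, which gives an exact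
-- recurrence for α; nesting 2 may also arise from other entries, so β only has a lower bound, and
-- this is the direction that the comparison of zeros needs. Real-rootedness is not read off the
-- factorisation: for Cauchy reals a vanishing product does not tell which factor vanishes. Instead
-- the imaginary part of a zero is shown to tend to 0 by an inequality between rationals that holds
-- term by term.

private
  variable
    A B : Set
    m n : ℕ

∈-∷-++⁻ : ∀ {y z : A} ys {zs} → z ∈ ys ++ y ∷ zs → z ≢ y → z ∈ ys ++ zs
∈-∷-++⁻ ys z∈ z≢y with ∈.∈-++⁻ ys z∈
... | inj₁ z∈ys         = ∈.∈-++⁺ˡ z∈ys
... | inj₂ (here z≡y)   = contradiction z≡y z≢y
... | inj₂ (there z∈zs) = ∈.∈-++⁺ʳ ys z∈zs

-- Induction on `xs`: one occurrence of the partner of the head is deleted from `ys`. By injectivity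
-- no other element of `xs` has that partner, so the remaining partners survive the deletion.
length-≤ : ∀ (R : A → B → Set) → (∀ {x x′ y} → R x y → R x′ y → x ≡ x′) →
           ∀ {xs ys} → Unique xs → All (λ x → ∃ λ y → y ∈ ys × R x y) xs →
           length xs ≤ length ys
length-≤ R inj [] [] = z≤n
length-≤ R inj {x ∷ xs} (x∉xs ∷ uniq) ((y , y∈ys , Rxy) ∷ related)
  with ys , zs , refl ← ∈.∈-∃++ y∈ys =
  subst (suc (length xs) ≤_) (sym lengths) (s≤s (length-≤ R inj uniq
    (All.zipWith (λ (x≢x′ , z , z∈ , Rx′z) →
        z , ∈-∷-++⁻ ys z∈ (λ z≡y → x≢x′ (inj Rxy (subst (R _) z≡y Rx′z))) , Rx′z)
      (x∉xs , related))))
  where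
  lengths : length (ys ++ y ∷ zs) ≡ suc (length (ys ++ zs))
  lengths = trans (length-++ ys) (trans (ℕ.+-suc (length ys) (length zs))
              (cong suc (sym (length-++ ys))))

length-filter-≤ :
  ∀ (R : A → B → Set) → (∀ {x x′ y} → R x y → R x′ y → x ≡ x′) →
  ∀ {P : A → Set} (P? : Decidable P) {xs ys} → Unique xs →
  (∀ {x} → x ∈ xs → P x → ∃ λ y → y ∈ ys × R x y) →
  length (filter P? xs) ≤ length ys
length-filter-≤ R inj P? {xs} uniq f =
  length-≤ R inj (Unique.filter⁺ P? uniq)
    (All.tabulate λ x∈ → let x∈xs , Px = ∈.∈-filter⁻ P? {xs = xs} x∈ in f x∈xs Px)

-- Peak-cliques are determined by their largest vertex

leftEnd : Vec ℕ n → Fin n → ℕ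
leftEnd a j = toℕ j ∸ lookup a j

-- For an area sequence this says that `leftEnd` increases strictly from j to j + 1, so the clique
-- ending in j does not extend to the right. The last vertex satisfies it vacuously.
IsTop : Vec ℕ n → Fin n → Set
IsTop a j = ∀ k → toℕ k ≡ suc (toℕ j) → lookup a k ≤ lookup a j

-- The vertex j stands for the peak-clique from `leftEnd a j` to j.
Covers : Vec ℕ n → Fin n → Fin n → Set
Covers a v j = IsTop a j × leftEnd a j ≤ toℕ v × toℕ v ≤ toℕ j

covers? : ∀ (a : Vec ℕ n) v → Decidable (Covers a v)
covers? a v j =
  Fin.all? (λ k → (toℕ k ℕ.≟ suc (toℕ j)) →-dec (lookup a k ℕ.≤? lookup a j))
  ×-dec (leftEnd a j ℕ.≤? toℕ v) ×-dec (toℕ v ℕ.≤? toℕ j)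

opaque
  coverNumber : Vec ℕ n → Fin n → ℕ
  coverNumber {n} a v = length (filter (covers? a v) (allFin n))

module _ {a : Vec ℕ n} (area : IsAreaSequence a) where
  open IsAreaSequence area

  entry≤ : ∀ i → lookup a i ≤ toℕ i
  entry≤ i = ℕ.s≤s⁻¹ (bounded i)

  -- The growth condition on area sequences, read as monotonicity of left ends.
  leftEnd-step : ∀ i k → toℕ k ≡ suc (toℕ i) → leftEnd a i ≤ leftEnd a k
  leftEnd-step i k k≡ = subst (λ m → leftEnd a i ≤ m ∸ lookup a k) (sym k≡)
    (ℕ.∸-monoʳ-≤ (suc (toℕ i)) (step i k k≡))

  leftEnd-mono′ : ∀ d i k → toℕ k ≡ d ℕ.+ toℕ i → leftEnd a i ≤ leftEnd a k
  leftEnd-mono′ zero    i k k≡ = ℕ.≤-reflexive (cong (leftEnd a) (sym (Fin.toℕ-injective k≡)))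
  leftEnd-mono′ (suc d) i k k≡ =
    ℕ.≤-trans (leftEnd-mono′ d i p (Fin.toℕ-fromℕ< d+i<n))
      (leftEnd-step p k (trans k≡ (cong suc (sym (Fin.toℕ-fromℕ< d+i<n)))))
    where
    d+i<n : d ℕ.+ toℕ i < n
    d+i<n = ℕ.<-trans (subst (d ℕ.+ toℕ i <_) (sym k≡) (ℕ.n<1+n _)) (Fin.toℕ<n k)
    p : Fin n
    p = fromℕ< d+i<n

  leftEnd-mono : ∀ i k → toℕ i ≤ toℕ k → leftEnd a i ≤ leftEnd a k
  leftEnd-mono i k i≤k = leftEnd-mono′ _ i k (sym (ℕ.m∸n+n≡m i≤k))

  top-step : ∀ j k → toℕ k ≡ suc (toℕ j) → lookup a k ≤ lookup a j →
             leftEnd a j < leftEnd a k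
  top-step j k k≡ ak≤aj = begin
    -- Subtraction is truncated, so moving `suc` inside needs the bound on the entry.
    suc (toℕ j ∸ lookup a j) ≡⟨ ℕ.+-∸-assoc 1 (entry≤ j) ⟨
    suc (toℕ j) ∸ lookup a j ≤⟨ ℕ.∸-monoʳ-≤ (suc (toℕ j)) ak≤aj ⟩
    suc (toℕ j) ∸ lookup a k ≡⟨ cong (_∸ lookup a k) k≡ ⟨
    leftEnd a k              ∎
    where open ℕ.≤-Reasoning

  leftEnd<⇒≤ : ∀ j k → toℕ k ≡ suc (toℕ j) → leftEnd a j < leftEnd a k →
               lookup a k ≤ lookup a j
  leftEnd<⇒≤ j k k≡ lt = ℕ.≮⇒≥ λ aj<ak → ℕ.<⇒≱ lt
    (subst (λ m → m ∸ lookup a k ≤ leftEnd a j) (sym k≡) (ℕ.∸-monoʳ-≤ (suc (toℕ j)) aj<ak))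

  predFin : ∀ {m} (j : Fin n) → m < toℕ j → ∃ λ p → suc (toℕ {n} p) ≡ toℕ j
  predFin j m<j = fromℕ< p<n , trans (cong suc (Fin.toℕ-fromℕ< p<n)) j≡
    where
    j≡ : suc (ℕ.pred (toℕ j)) ≡ toℕ j
    j≡ = ℕ.suc-pred (toℕ j) ⦃ ℕ.>-nonZero (ℕ.≤-<-trans z≤n m<j) ⦄
    p<n : ℕ.pred (toℕ j) < n
    p<n = subst (_≤ n) (sym j≡) (ℕ.<⇒≤ (Fin.toℕ<n j))

  -- An isolated vertex has entry 0, as a positive entry would join it to its predecessor. For a
  -- proper edge the missing edge from i - 1 makes i the leftmost neighbour of j. In both cases the
  -- missing edge to j + 1 is a strict increase of `leftEnd`.
  peakEdge⇒top : ∀ {i j} → IsPeakEdge a i j → toℕ i ≡ leftEnd a j × IsTop a j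
  peakEdge⇒top {i} (inj₁ (refl , isolated)) =
    cong (toℕ i ∸_) (sym ai≡0) , λ k k≡ → leftEnd<⇒≤ i k k≡
      (subst (_< leftEnd a k) (cong (toℕ i ∸_) (sym ai≡0))
        (ℕ.≰⇒> λ le → isolated k (inj₁ (mkEdge (subst (toℕ i <_) (sym k≡) (ℕ.n<1+n _)) le))))
    where
    ai≡0 : lookup a i ≡ 0
    ai≡0 = ℕ.n<1⇒n≡0 (ℕ.≰⇒> λ 0<ai →
      let p , p≡ = predFin i (ℕ.<-≤-trans 0<ai (entry≤ i)) in
      isolated p (inj₂ (mkEdge (ℕ.≤-reflexive p≡)
        (subst (λ m → m ∸ lookup a i ≤ toℕ p) p≡ (ℕ.∸-monoʳ-≤ (suc (toℕ p)) 0<ai)))))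
  peakEdge⇒top {i} {j} (inj₂ (mkEdge i<j le , noRight , noLeft)) =
    i≡ , λ k k≡ → leftEnd<⇒≤ j k k≡
      (subst (_< leftEnd a k) i≡ (ℕ.≰⇒> λ le′ → noRight k k≡
        (mkEdge (ℕ.<-trans i<j (subst (toℕ j <_) (sym k≡) (ℕ.n<1+n _))) le′)))
    where
    i≡ : toℕ i ≡ leftEnd a j
    i≡ = ℕ.≤-antisym (ℕ.≮⇒≥ λ lt →
      let p , p≡ = predFin i lt in
      noLeft p p≡ (mkEdge (ℕ.<-trans (ℕ.≤-reflexive p≡) i<j)
        (ℕ.s≤s⁻¹ (subst (leftEnd a j <_) (sym p≡) lt)))) le

  top⇒peakEdge : ∀ {i j} → toℕ i ≡ leftEnd a j → IsTop a j → IsPeakEdge a i j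
  top⇒peakEdge {i} {j} i≡ top with lookup a j ℕ.≟ 0
  ... | yes aj≡0 = inj₁ (i≡j , isolated)
    where
    i≡j : i ≡ j
    i≡j = Fin.toℕ-injective (trans i≡ (cong (toℕ j ∸_) aj≡0))
    isolated : IsIsolated a i
    -- A neighbour l to the right has left end at most i; by monotonicity so has the successor k of
    -- j, against the strict increase at a top.
    isolated l (inj₁ (mkEdge i<l le)) = ℕ.<⇒≱ (top-step j k k≡ (top k k≡))
      (ℕ.≤-trans (leftEnd-mono k l (subst (_≤ toℕ l) (sym k≡) j<l))
        (ℕ.≤-trans le (ℕ.≤-reflexive i≡)))
      where
      j<l : toℕ j < toℕ l
      j<l = subst (λ v → toℕ v < toℕ l) i≡j i<l
      1+j<n : suc (toℕ j) < n
      1+j<n = ℕ.≤-<-trans j<l (Fin.toℕ<n l)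
      k : Fin n
      k = fromℕ< 1+j<n
      k≡ : toℕ k ≡ suc (toℕ j)
      k≡ = Fin.toℕ-fromℕ< 1+j<n
    isolated l (inj₂ (mkEdge l<i le)) = ℕ.<⇒≱ l<i
      (subst (_≤ toℕ l) (trans (cong (leftEnd a) i≡j) (sym i≡)) le)
  ... | no aj≢0 = inj₂
    ( mkEdge i<j (ℕ.≤-reflexive (sym i≡))
    , (λ k k≡ (mkEdge _ le) → ℕ.<⇒≱ (top-step j k k≡ (top k k≡)) (subst (leftEnd a k ≤_) i≡ le))
    , (λ k k≡ (mkEdge _ le) → ℕ.<⇒≱ (ℕ.≤-reflexive k≡) (subst (_≤ toℕ k) (sym i≡) le)))
    where
    i<j : toℕ i < toℕ j
    i<j = subst (_< toℕ j) (sym i≡)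
      (ℕ.∸-monoʳ-< {toℕ j} (ℕ.n≢0⇒n>0 aj≢0) (entry≤ j))

  opaque
    unfolding coverNumber
    -- A pair (i , j) is matched with j. Passing from pairs to j loses nothing because i is
    -- recovered as `leftEnd a j`.
    peakNesting≡coverNumber : ∀ v → peakNesting a v ≡ coverNumber a v
    peakNesting≡coverNumber v = ℕ.≤-antisym
      (length-filter-≤ (λ (i , j) j′ → (toℕ i ≡ leftEnd a j) × j ≡ j′)
        (λ { (i≡ , refl) (i′≡ , refl) → cong (_, _) (Fin.toℕ-injective (trans i≡ (sym i′≡))) })
        (isPeakCliqueAt? a v) (Unique.cartesianProduct⁺ (Unique.allFin⁺ n) (Unique.allFin⁺ n))
        (λ { {i , j} _ (peak , i≤v , v≤j) → let i≡ , top = peakEdge⇒top peak in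
             j , ∈.∈-filter⁺ (covers? a v) (∈.∈-allFin j) (top , subst (_≤ toℕ v) i≡ i≤v , v≤j)
               , i≡ , refl }))
      (length-filter-≤ (λ j′ (i , j) → j ≡ j′) (λ { refl refl → refl })
        (covers? a v) (Unique.allFin⁺ n)
        (λ { {j} _ (top , le , v≤j) →
             let i<n = ℕ.≤-<-trans (ℕ.m∸n≤m (toℕ j) (lookup a j)) (Fin.toℕ<n j)
                 i≡  = Fin.toℕ-fromℕ< i<n
             in (fromℕ< i<n , j)
               , ∈.∈-filter⁺ (isPeakCliqueAt? a v)
                   (∈.∈-cartesianProduct⁺ (∈.∈-allFin _) (∈.∈-allFin j))
                   (top⇒peakEdge i≡ top , subst (_≤ toℕ v) (sym i≡) le , v≤j)
               , refl }))

  pnest≥ : ∀ v → coverNumber a v ≤ pnest a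
  pnest≥ v = subst (_≤ pnest a) (peakNesting≡coverNumber v)
    (All.lookup (Extrema.xs≤max 0 (map (peakNesting a) (allFin n)))
      (∈.∈-map⁺ (peakNesting a) (∈.∈-allFin v)))

  pnest≤ : ∀ {k} → (∀ v → coverNumber a v ≤ k) → pnest a ≤ k
  pnest≤ {k} f = Extrema.max≤v⁺ z≤n (All.map⁺ {xs = allFin n} (All.tabulate λ {v} _ →
    subst (_≤ k) (sym (peakNesting≡coverNumber v)) (f v)))

opaque
  unfolding coverNumber
  coverNumber≥ : ∀ (a : Vec ℕ n) v {js} → Unique js → All (Covers a v) js →
                 length js ≤ coverNumber a v
  coverNumber≥ a v uniq covers =
    length-≤ _≡_ (λ { refl refl → refl }) uniq
      (All.map (λ {j} c → j , ∈.∈-filter⁺ (covers? a v) (∈.∈-allFin j) c , refl) covers)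

opaque
  unfolding coverNumber
  coverNumber-mono :
    ∀ (R : Fin m → Fin n → Set) → (∀ {j j′ k} → R j k → R j′ k → j ≡ j′) →
    ∀ (a : Vec ℕ m) (b : Vec ℕ n) v w →
    (∀ {j} → Covers a v j → ∃ λ k → Covers b w k × R j k) →
    coverNumber a v ≤ coverNumber b w
  coverNumber-mono R inj a b v w f =
    length-filter-≤ R inj (covers? a v) (Unique.allFin⁺ _) λ _ c →
      let k , c′ , Rjk = f c in k , ∈.∈-filter⁺ (covers? b w) (∈.∈-allFin k) c′ , Rjk

last-covers : ∀ (a : Vec ℕ (suc n)) → Covers a (fromℕ n) (fromℕ n)
last-covers {n} a =
    (λ k k≡ → contradiction (subst (λ m → toℕ k ≡ suc m) (Fin.toℕ-fromℕ n) k≡)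
                (ℕ.<⇒≢ (Fin.toℕ<n k)))
  , ℕ.m∸n≤m _ (lookup a (fromℕ n)) , ℕ.≤-refl

opaque
  unfolding coverNumber
  -- A peak-clique that contains the last vertex ends there, and its end determines it.
  coverNumber-last≤1 : ∀ (a : Vec ℕ (suc n)) → coverNumber a (fromℕ n) ≤ 1
  coverNumber-last≤1 {n} a =
    length-filter-≤ _≡_ (λ { refl refl → refl }) (covers? a (fromℕ n)) {ys = fromℕ n ∷ []}
      (Unique.allFin⁺ _) λ {j} _ (_ , _ , n≤j) →
        j , here (Fin.toℕ-injective (ℕ.≤-antisym (Fin.≤fromℕ j) n≤j)) , refl

-- The last vertex always lies in the peak-clique that ends in it. This is what removes the constant
-- coefficient later.
pnest≥1 : ∀ {a : Vec ℕ (suc n)} → IsAreaSequence a → 1 ≤ pnest a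
pnest≥1 {a = a} area =
  ℕ.≤-trans (coverNumber≥ a (fromℕ _) ([] ∷ []) (last-covers a ∷ [])) (pnest≥ area (fromℕ _))

-- Appending an entry

lookup-∷ʳ-inject₁ : ∀ (v : Vec A n) x i → lookup (v ∷ʳ x) (inject₁ i) ≡ lookup v i
lookup-∷ʳ-inject₁ (_ ∷ _) x Fin.zero    = refl
lookup-∷ʳ-inject₁ (_ ∷ v) x (Fin.suc i) = lookup-∷ʳ-inject₁ v x i

lookup-∷ʳ-fromℕ : ∀ (v : Vec A n) x → lookup (v ∷ʳ x) (fromℕ n) ≡ x
lookup-∷ʳ-fromℕ []      x = refl
lookup-∷ʳ-fromℕ (_ ∷ v) x = lookup-∷ʳ-fromℕ v x

final : Vec ℕ (suc n) → ℕ
final {n} a = lookup a (fromℕ n)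

data Consecutive {n} : Fin (suc (suc n)) → Fin (suc (suc n)) → Set where
  inner : ∀ {i k} → toℕ k ≡ suc (toℕ i) → Consecutive (inject₁ i) (inject₁ k)
  outer : Consecutive (inject₁ (fromℕ n)) (fromℕ (suc n))

consecutive : ∀ {n} (i k : Fin (suc (suc n))) → toℕ k ≡ suc (toℕ i) → Consecutive i k
consecutive {n} i k k≡ with view i | view k
... | ‵inject₁ i′ | ‵inject₁ k′ =
  inner (trans (sym (Fin.toℕ-inject₁ k′)) (trans k≡ (cong suc (Fin.toℕ-inject₁ i′))))
... | ‵inject₁ i′ | ‵fromℕ
  with refl ← Fin.toℕ-injective
         (trans (ℕ.suc-injective k≡) (Fin.toℕ-inject₁ i′)) = outer
... | ‵fromℕ | _ =
  contradiction k≡ (ℕ.<⇒≢ (ℕ.<-≤-trans (Fin.toℕ<n k) (ℕ.≤-reflexive (cong suc (sym (Fin.toℕ-fromℕ (suc n)))))))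

inject₁-consecutive : ∀ {i k : Fin n} → toℕ k ≡ suc (toℕ i) →
                      toℕ (inject₁ k) ≡ suc (toℕ (inject₁ i))
inject₁-consecutive {i = i} {k} k≡ =
  trans (Fin.toℕ-inject₁ k) (trans k≡ (cong suc (sym (Fin.toℕ-inject₁ i))))

outer-consecutive : ∀ n → toℕ (fromℕ (suc n)) ≡ suc (toℕ (inject₁ (fromℕ n)))
outer-consecutive n = cong suc (sym (Fin.toℕ-inject₁ (fromℕ n)))

module _ (a : Vec ℕ (suc n)) (x : ℕ) where
  private
    inside = lookup-∷ʳ-inject₁ a x
    final≡ = lookup-∷ʳ-fromℕ a x

  leftEnd-inject₁ : ∀ j → leftEnd (a ∷ʳ x) (inject₁ j) ≡ leftEnd a j
  leftEnd-inject₁ j = cong₂ _∸_ (Fin.toℕ-inject₁ j) (inside j)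

  area-∷ʳ⁺ : IsAreaSequence a → x ≤ suc (final a) → IsAreaSequence (a ∷ʳ x)
  area-∷ʳ⁺ (mkArea bounded step) x≤ = mkArea bounded′ step′
    where
    bounded′ : ∀ i → lookup (a ∷ʳ x) i < suc (toℕ i)
    bounded′ i with view i
    ... | ‵inject₁ i = subst₂ _<_ (sym (inside i)) (cong suc (sym (Fin.toℕ-inject₁ i))) (bounded i)
    -- The bound on the new entry follows from the growth condition and the bound on the old last
    -- entry.
    ... | ‵fromℕ     = subst (_< _) (sym final≡) (s≤s (ℕ.≤-trans x≤ (bounded (fromℕ n))))
    step′ : ∀ i k → toℕ k ≡ suc (toℕ i) → lookup (a ∷ʳ x) k ≤ suc (lookup (a ∷ʳ x) i)
    step′ i k k≡ with consecutive i k k≡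
    ... | inner {i} {k} k≡ = subst₂ _≤_ (sym (inside k)) (cong suc (sym (inside i))) (step i k k≡)
    ... | outer = subst₂ _≤_ (sym final≡) (cong suc (sym (inside (fromℕ n)))) x≤

  area-∷ʳ⁻ : IsAreaSequence (a ∷ʳ x) → IsAreaSequence a × x ≤ suc (final a)
  area-∷ʳ⁻ (mkArea bounded step) =
    mkArea
      (λ i → subst₂ _<_ (inside i) (cong suc (Fin.toℕ-inject₁ i)) (bounded (inject₁ i)))
      (λ i k k≡ → subst₂ _≤_ (inside k) (cong suc (inside i))
        (step (inject₁ i) (inject₁ k) (inject₁-consecutive k≡)))
    , subst₂ _≤_ final≡ (cong suc (inside (fromℕ n)))
        (step (inject₁ (fromℕ n)) (fromℕ (suc n)) (outer-consecutive n))

  -- Connectedness is followed through consecutive edges, where an appended vertex adds a single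
  -- condition: the edge to its predecessor, present exactly when its entry is positive.
  consecutiveEdges-∷ʳ⁺ : ConsecutiveEdges a → 0 < x → ConsecutiveEdges (a ∷ʳ x)
  consecutiveEdges-∷ʳ⁺ ce 0<x i k k≡ with consecutive i k k≡
  ... | inner {i} {k} k≡′ = mkEdge (ℕ.≤-reflexive (sym k≡))
    (subst₂ _≤_ (sym (leftEnd-inject₁ k)) (sym (Fin.toℕ-inject₁ i)) (Edge.inRange (ce i k k≡′)))
  ... | outer = mkEdge (ℕ.≤-reflexive (sym k≡))
    (subst₂ (λ u v → suc (toℕ (fromℕ n)) ∸ u ≤ v) (sym final≡) (sym (Fin.toℕ-inject₁ (fromℕ n)))
      (ℕ.∸-monoʳ-≤ (suc (toℕ (fromℕ n))) 0<x))

  consecutiveEdges-∷ʳ⁻ : ConsecutiveEdges (a ∷ʳ x) → ConsecutiveEdges a × 0 < x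
  consecutiveEdges-∷ʳ⁻ ce =
      (λ i k k≡ → mkEdge (ℕ.≤-reflexive (sym k≡))
        (subst₂ _≤_ (leftEnd-inject₁ k) (Fin.toℕ-inject₁ i)
          (Edge.inRange (ce (inject₁ i) (inject₁ k) (inject₁-consecutive k≡)))))
    , ℕ.n≢0⇒n>0 λ x≡0 → ℕ.<⇒≱ (ℕ.n<1+n _)
        (subst₂ (λ u v → suc (toℕ (fromℕ n)) ∸ u ≤ v)
          (trans final≡ x≡0) (Fin.toℕ-inject₁ (fromℕ n))
          (Edge.inRange (ce (inject₁ (fromℕ n)) (fromℕ (suc n)) (outer-consecutive n))))

  -- Only the old last vertex gains a successor, so only there is a condition on `x` required.
  top-inject₁⁺ : ∀ {j} → IsTop a j → (j ≡ fromℕ n → x ≤ lookup a j) → IsTop (a ∷ʳ x) (inject₁ j)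
  top-inject₁⁺ {j} top last k k≡ with view k
  ... | ‵inject₁ k = subst₂ _≤_ (sym (inside k)) (sym (inside j)) (top k
          (trans (sym (Fin.toℕ-inject₁ k)) (trans k≡ (cong suc (Fin.toℕ-inject₁ j)))))
  ... | ‵fromℕ     = subst₂ _≤_ (sym final≡) (sym (inside j))
          (last (sym (Fin.toℕ-injective (trans (ℕ.suc-injective k≡) (Fin.toℕ-inject₁ j)))))

  top-inject₁⁻ : ∀ {j} → IsTop (a ∷ʳ x) (inject₁ j) → IsTop a j
  top-inject₁⁻ {j} top k k≡ =
    subst₂ _≤_ (inside k) (inside j) (top (inject₁ k) (inject₁-consecutive k≡))

  covers-inject₁⁺ : ∀ {v j} → Covers a v j → (j ≡ fromℕ n → x ≤ lookup a j) →
                    Covers (a ∷ʳ x) (inject₁ v) (inject₁ j)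
  covers-inject₁⁺ {v} {j} (top , le , v≤j) last =
      top-inject₁⁺ top last
    , subst₂ _≤_ (sym (leftEnd-inject₁ j)) (sym (Fin.toℕ-inject₁ v)) le
    , subst₂ _≤_ (sym (Fin.toℕ-inject₁ v)) (sym (Fin.toℕ-inject₁ j)) v≤j

  covers-inject₁⁻ : ∀ {v j} → Covers (a ∷ʳ x) (inject₁ v) (inject₁ j) → Covers a v j
  covers-inject₁⁻ {v} {j} (top , le , v≤j) =
      top-inject₁⁻ top
    , subst₂ _≤_ (leftEnd-inject₁ j) (Fin.toℕ-inject₁ v) le
    , subst₂ _≤_ (Fin.toℕ-inject₁ v) (Fin.toℕ-inject₁ j) v≤j

  -- Comparing the old vertices is enough: the new vertex is covered at most once, and `pnest a` is
  -- at least 1, so it cannot raise the maximum.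
  pnest-∷ʳ : IsAreaSequence a → IsAreaSequence (a ∷ʳ x) →
             (∀ v → coverNumber a v ≡ coverNumber (a ∷ʳ x) (inject₁ v)) → pnest (a ∷ʳ x) ≡ pnest a
  pnest-∷ʳ areaA areaB eq = ℕ.≤-antisym
    (pnest≤ areaB (λ w → boundᵛ (view w)))
    (pnest≤ areaA λ v → subst (_≤ pnest (a ∷ʳ x)) (sym (eq v)) (pnest≥ areaB (inject₁ v)))
    where
    boundᵛ : ∀ {w} → View w → coverNumber (a ∷ʳ x) w ≤ pnest a
    boundᵛ (‵inject₁ v) = subst (_≤ pnest a) (eq v) (pnest≥ areaA v)
    boundᵛ ‵fromℕ       = ℕ.≤-trans {j = 1} (coverNumber-last≤1 (a ∷ʳ x)) (pnest≥1 {a = a} areaA)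

  -- The peak-cliques ending in the last two vertices share the penultimate one.
  pnest-∷ʳ≥2 : IsAreaSequence (a ∷ʳ x) → 0 < x → x ≤ final a → 2 ≤ pnest (a ∷ʳ x)
  pnest-∷ʳ≥2 areaB 0<x x≤ = ℕ.≤-trans
    (coverNumber≥ (a ∷ʳ x) (inject₁ (fromℕ n))
      ((Fin.fromℕ≢inject₁ ∘ sym ∷ []) ∷ [] ∷ [])
      (covers-inject₁⁺ (last-covers a) (λ _ → x≤)
       ∷ (proj₁ (last-covers (a ∷ʳ x))
         , subst₂ (λ u v → suc (toℕ (fromℕ n)) ∸ u ≤ v) (sym final≡) (sym (Fin.toℕ-inject₁ (fromℕ n)))
             (ℕ.∸-monoʳ-≤ (suc (toℕ (fromℕ n))) 0<x)
         , subst (_≤ suc (toℕ (fromℕ n))) (sym (Fin.toℕ-inject₁ (fromℕ n))) (ℕ.n≤1+n _)) ∷ []))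
    (pnest≥ areaB (inject₁ (fromℕ n)))

-- Extensions that preserve the peak-nesting

data Extension : Set where
  isolate enlarge : Extension

extend : Vec ℕ (suc n) → Extension → ℕ
extend a isolate = 0
extend a enlarge = suc (final a)

-- An entry 0 exceeds no old entry, so every old top remains one; the new peak-clique consists of
-- the new vertex alone and covers no old vertex.
coverNumber-isolate : ∀ (a : Vec ℕ (suc n)) v →
                      coverNumber a v ≡ coverNumber (a ∷ʳ 0) (inject₁ v)
coverNumber-isolate {n} a v = ℕ.≤-antisym
  (coverNumber-mono (λ j k → k ≡ inject₁ j)
    (λ { refl eq → Fin.inject₁-injective eq }) a (a ∷ʳ 0) v (inject₁ v)
    λ {j} c → inject₁ j , covers-inject₁⁺ a 0 c (λ _ → z≤n) , refl)
  (coverNumber-mono (λ k j → k ≡ inject₁ j) (λ { refl refl → refl }) (a ∷ʳ 0) a (inject₁ v) v back)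
  where
  back : ∀ {k} → Covers (a ∷ʳ 0) (inject₁ v) k → ∃ λ j → Covers a v j × k ≡ inject₁ j
  back {k} c@(_ , le , _) with view k
  ... | ‵inject₁ j = j , covers-inject₁⁻ a 0 c , refl
  ... | ‵fromℕ     = contradiction
    (subst₂ (λ u w → suc (toℕ (fromℕ n)) ∸ u ≤ w) (lookup-∷ʳ-fromℕ a 0) (Fin.toℕ-inject₁ v) le)
    (ℕ.<⇒≱ (s≤s (Fin.≤fromℕ v)))

-- The old last vertex stops being a top, because its successor has a larger entry. The new vertex
-- takes its place with the same left end, so the peak-clique covers the same old vertices; `Moved`
-- records this replacement and fixes all other tops.
coverNumber-enlarge : ∀ (a : Vec ℕ (suc n)) v →
                      coverNumber a v ≡ coverNumber (a ∷ʳ suc (final a)) (inject₁ v)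
coverNumber-enlarge {n} a v = ℕ.≤-antisym
  (coverNumber-mono Moved
    (λ { (inj₁ (_ , refl)) (inj₁ (_ , eq)) → Fin.inject₁-injective eq
       ; (inj₁ (_ , refl)) (inj₂ (_ , eq)) → contradiction (sym eq) Fin.fromℕ≢inject₁
       ; (inj₂ (_ , refl)) (inj₁ (_ , eq)) → contradiction eq Fin.fromℕ≢inject₁
       ; (inj₂ (refl , _)) (inj₂ (refl , _)) → refl })
    a b v (inject₁ v) forth)
  (coverNumber-mono (λ k j → Moved j k)
    (λ { (inj₁ (_ , refl)) (inj₁ (_ , refl)) → refl
       ; (inj₁ (j≢n , _)) (inj₂ (j≡n , _)) → contradiction j≡n j≢n
       ; (inj₂ (j≡n , _)) (inj₁ (j≢n , _)) → contradiction j≡n j≢n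
       ; (inj₂ (_ , refl)) (inj₂ (_ , refl)) → refl })
    b a (inject₁ v) v back)
  where
  x = suc (final a)
  b = a ∷ʳ x
  Moved : Fin (suc n) → Fin (suc (suc n)) → Set
  Moved j k = (j ≢ fromℕ n × k ≡ inject₁ j) ⊎ (j ≡ fromℕ n × k ≡ fromℕ (suc n))

  leftEnd≡ : leftEnd b (fromℕ (suc n)) ≡ leftEnd a (fromℕ n)
  -- Position and entry both grow by 1, and the two successors cancel by computation.
  leftEnd≡ = cong (suc (toℕ (fromℕ n)) ∸_) (lookup-∷ʳ-fromℕ a x)

  forth : ∀ {j} → Covers a v j → ∃ λ k → Covers b (inject₁ v) k × Moved j k
  forth {j} c@(_ , le , _) with j Fin.≟ fromℕ n
  ... | no j≢n   = inject₁ j , covers-inject₁⁺ a x c (λ j≡n → contradiction j≡n j≢n)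
                 , inj₁ (j≢n , refl)
  ... | yes refl = fromℕ (suc n)
                 , ( proj₁ (last-covers b)
                   , subst₂ _≤_ (sym leftEnd≡) (sym (Fin.toℕ-inject₁ v)) le
                   , Fin.≤fromℕ (inject₁ v))
                 , inj₂ (refl , refl)

  back : ∀ {k} → Covers b (inject₁ v) k → ∃ λ j → Covers a v j × Moved j k
  back {k} c@(top , le , _) with view k
  ... | ‵inject₁ j = j , covers-inject₁⁻ a x c , inj₁ (j≢n , refl)
    where
    j≢n : j ≢ fromℕ n
    j≢n refl = ℕ.<⇒≱ (ℕ.n<1+n (final a))
      (subst₂ _≤_ (lookup-∷ʳ-fromℕ a x) (lookup-∷ʳ-inject₁ a x (fromℕ n))
        (top (fromℕ (suc n)) (outer-consecutive n)))
  ... | ‵fromℕ     = fromℕ n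
    , (proj₁ (last-covers a) , subst₂ _≤_ leftEnd≡ (Fin.toℕ-inject₁ v) le , Fin.≤fromℕ v)
    , inj₂ (refl , refl)

extend≤ : ∀ (a : Vec ℕ (suc n)) e → extend a e ≤ suc (final a)
extend≤ a isolate = z≤n
extend≤ a enlarge = ℕ.≤-refl

pnest-extend : ∀ {a : Vec ℕ (suc n)} → IsAreaSequence a → ∀ e →
               pnest (a ∷ʳ extend a e) ≡ pnest a
pnest-extend {a = a} area e =
  pnest-∷ʳ a (extend a e) area (area-∷ʳ⁺ a _ area (extend≤ a e)) (coverNumbers e)
  where
  coverNumbers : ∀ e v → coverNumber a v ≡ coverNumber (a ∷ʳ extend a e) (inject₁ v)
  coverNumbers isolate = coverNumber-isolate a
  coverNumbers enlarge = coverNumber-enlarge a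

pnest1⇒extend : ∀ (a : Vec ℕ (suc n)) x → IsAreaSequence (a ∷ʳ x) → pnest (a ∷ʳ x) ≡ 1 →
                ∃ λ e → x ≡ extend a e
pnest1⇒extend a x area pnest≡1 = classify (x ℕ.≟ 0) (x ℕ.≤? final a)
  where
  classify : Dec (x ≡ 0) → Dec (x ≤ final a) → ∃ λ e → x ≡ extend a e
  classify (yes x≡0) _        = isolate , x≡0
  classify (no _)    (no x≰)  = enlarge , ℕ.≤-antisym (proj₂ (area-∷ʳ⁻ a x area)) (ℕ.≰⇒> x≰)
  classify (no x≢0)  (yes x≤) = contradiction
    (subst (2 ≤_) pnest≡1 (pnest-∷ʳ≥2 a x area (ℕ.n≢0⇒n>0 x≢0) x≤)) ℕ.1+n≰n

extend-injective : ∀ (a : Vec ℕ (suc n)) {e e′} → extend a e ≡ extend a e′ → e ≡ e′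
extend-injective a {isolate} {isolate} _ = refl
extend-injective a {enlarge} {enlarge} _ = refl

-- Recurrences for the number of sequences with a given peak-nesting

boundedSequences-unique : ∀ n → Unique (boundedSequences n)
boundedSequences-unique zero    = [] ∷ []
boundedSequences-unique (suc n) =
  Unique.cartesianProductWith⁺ _∷ʳ_ (Vec.∷ʳ-injective _ _)
    (boundedSequences-unique n) (Unique.upTo⁺ (suc n))

∈-boundedSequences : ∀ {n} (a : Vec ℕ n) → (∀ i → lookup a i < suc (toℕ i)) →
                     a ∈ boundedSequences n
∈-boundedSequences [] _ = here refl
∈-boundedSequences {suc n} a bounded with initLast a
... | v , x , refl = ∈.∈-cartesianProductWith⁺ _∷ʳ_
  (∈-boundedSequences v λ i →
    subst₂ _<_ (lookup-∷ʳ-inject₁ v x i) (cong suc (Fin.toℕ-inject₁ i)) (bounded (inject₁ i)))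
  (∈.∈-upTo⁺ (subst₂ _<_ (lookup-∷ʳ-fromℕ v x) (cong suc (Fin.toℕ-fromℕ n)) (bounded (fromℕ n))))

-- All that the recurrences use of a family, so that both families are treated at once; the length
-- of `ways` is the factor m. Extension starts from size 1, since `enlarge` refers to a last entry.
record IsExtensible (𝓕 : ∀ n → List (Vec ℕ n)) (ways : List Extension) : Set where
  field
    unique      : ∀ n → Unique (𝓕 n)
    ways-unique : Unique ways
    area        : ∀ {n a} → a ∈ 𝓕 n → IsAreaSequence a
    extend⁺     : ∀ {n a e} → a ∈ 𝓕 (suc n) → e ∈ ways → a ∷ʳ extend a e ∈ 𝓕 (suc (suc n))
    extend⁻     : ∀ {n a e} → a ∷ʳ extend a e ∈ 𝓕 (suc (suc n)) → a ∈ 𝓕 (suc n) × e ∈ ways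

length-cartesianProduct : ∀ (xs : List A) (ys : List B) →
                          length (cartesianProduct xs ys) ≡ length xs ℕ.* length ys
length-cartesianProduct []       ys = refl
length-cartesianProduct (x ∷ xs) ys = trans (length-++ (map (x ,_) ys))
  (cong₂ ℕ._+_ (length-map (x ,_) ys) (length-cartesianProduct xs ys))

module Recurrence {𝓕 ways} (𝓕-extensible : IsExtensible 𝓕 ways) where
  open IsExtensible 𝓕-extensible

  hasPnest? : ∀ k → Decidable (λ (a : Vec ℕ n) → pnest a ≡ k)
  hasPnest? k a = pnest a ℕ.≟ k

  withPnest : ∀ k n → List (Vec ℕ n)
  withPnest k n = filter (hasPnest? k) (𝓕 n)

  count : ℕ → ℕ → ℕ
  count k n = length (withPnest k n)

  private
    Extends : Vec ℕ (suc n) × Extension → Vec ℕ (suc (suc n)) → Set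
    Extends (a , e) b = b ≡ a ∷ʳ extend a e

    extends-injective : ∀ {p q : Vec ℕ (suc n) × Extension} {b} →
                        Extends p b → Extends q b → p ≡ q
    extends-injective {p = a , e} {a′ , e′} refl eq with Vec.∷ʳ-injective a a′ eq
    ... | refl , e≡ = cong (a ,_) (extend-injective a e≡)

  -- Distinct pairs of a member and a way give distinct extensions of the same nesting, whatever `k`
  -- is.
  count-≥ : ∀ k n → count k (suc n) ℕ.* length ways ≤ count k (suc (suc n))
  count-≥ k n = subst (_≤ count k (suc (suc n)))
    (length-cartesianProduct (withPnest k (suc n)) ways)
    (length-≤ Extends extends-injective
      (Unique.cartesianProduct⁺ (Unique.filter⁺ (hasPnest? k) (unique (suc n))) ways-unique)
      (All.tabulate λ { {a , e} p →
        let a∈ , e∈ = ∈.∈-cartesianProduct⁻ (withPnest k (suc n)) ways p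
            a∈𝓕 , pnest≡k = ∈.∈-filter⁻ (hasPnest? k) {xs = 𝓕 (suc n)} a∈
        in a ∷ʳ extend a e
         , ∈.∈-filter⁺ (hasPnest? k) (extend⁺ a∈𝓕 e∈) (trans (pnest-extend (area a∈𝓕) e) pnest≡k)
         , refl }))

  -- For nesting 1 the last entry must come from one of the two extensions, so splitting it off
  -- recovers a pair of a member and a way.
  count₁-≤ : ∀ n → count 1 (suc (suc n)) ≤ count 1 (suc n) ℕ.* length ways
  count₁-≤ n = subst (count 1 (suc (suc n)) ≤_)
    (length-cartesianProduct (withPnest 1 (suc n)) ways)
    (length-filter-≤ (λ b p → Extends p b) (λ { refl refl → refl }) (hasPnest? 1)
      (unique (suc (suc n))) λ {b} → shorten b)
    where
    shorten : ∀ b → b ∈ 𝓕 (suc (suc n)) → pnest b ≡ 1 →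
              ∃ λ p → p ∈ cartesianProduct (withPnest 1 (suc n)) ways × Extends p b
    shorten b b∈ pnest≡1 =
      let a , x , b≡      = initLast b
          areaAx          = subst IsAreaSequence b≡ (area b∈)
          e , x≡          = pnest1⇒extend a x areaAx (trans (cong pnest (sym b≡)) pnest≡1)
          b≡extend        = trans b≡ (cong (a ∷ʳ_) x≡)
          a∈ , e∈         = extend⁻ (subst (_∈ 𝓕 (suc (suc n))) b≡extend b∈)
          pnest-a≡1       = trans (sym (pnest-extend (area a∈) e))
                              (trans (cong pnest (sym b≡extend)) pnest≡1)
      in (a , e)
       , ∈.∈-cartesianProduct⁺ (∈.∈-filter⁺ (hasPnest? 1) a∈ pnest-a≡1) e∈
       , b≡extend

-- The 2-nested and the connected 2-nested families are extensible

∈-𝒩₂⁺ : ∀ {a : Vec ℕ n} → Is2Nested a → a ∈ 𝒩₂ n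
∈-𝒩₂⁺ {a = a} p =
  ∈.∈-filter⁺ is2Nested? (∈-boundedSequences a (IsAreaSequence.bounded (proj₁ p))) p

∈-𝒩₂⁻ : ∀ {a : Vec ℕ n} → a ∈ 𝒩₂ n → Is2Nested a
∈-𝒩₂⁻ {n} a∈ = proj₂ (∈.∈-filter⁻ is2Nested? {xs = boundedSequences n} a∈)

∈-𝒩₂ᶜ⁺ : ∀ {a : Vec ℕ n} → IsConnected2Nested a → a ∈ 𝒩₂ᶜ n
∈-𝒩₂ᶜ⁺ {a = a} p = ∈.∈-filter⁺ isConnected2Nested?
  (∈-boundedSequences a (IsAreaSequence.bounded (proj₁ (proj₁ p)))) p

∈-𝒩₂ᶜ⁻ : ∀ {a : Vec ℕ n} → a ∈ 𝒩₂ᶜ n → IsConnected2Nested a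
∈-𝒩₂ᶜ⁻ {n} a∈ = proj₂ (∈.∈-filter⁻ isConnected2Nested? {xs = boundedSequences n} a∈)

2nested-extend⁺ : ∀ (a : Vec ℕ (suc n)) e → Is2Nested a → Is2Nested (a ∷ʳ extend a e)
2nested-extend⁺ a e (area , ≤2) =
  area-∷ʳ⁺ a (extend a e) area (extend≤ a e) , ℕ.≤-trans (ℕ.≤-reflexive (pnest-extend area e)) ≤2

2nested-extend⁻ : ∀ (a : Vec ℕ (suc n)) e → Is2Nested (a ∷ʳ extend a e) → Is2Nested a
2nested-extend⁻ a e (area , ≤2) =
  areaA , ℕ.≤-trans (ℕ.≤-reflexive (sym (pnest-extend areaA e))) ≤2
  where
  areaA : IsAreaSequence a
  areaA = proj₁ (area-∷ʳ⁻ a (extend a e) area)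

connected-extend⁺ : ∀ (a : Vec ℕ (suc n)) → IsConnected2Nested a →
                    IsConnected2Nested (a ∷ʳ extend a enlarge)
connected-extend⁺ a (nested , conn) = 2nested-extend⁺ a enlarge nested ,
  consecutive⇒connected
    (consecutiveEdges-∷ʳ⁺ a _ (connected⇒consecutive (proj₁ nested) conn) (s≤s z≤n))

connected-extend⁻ : ∀ (a : Vec ℕ (suc n)) e → IsConnected2Nested (a ∷ʳ extend a e) →
                    IsConnected2Nested a × e ∈ enlarge ∷ []
connected-extend⁻ a e (nested , conn) =
  (2nested-extend⁻ a e nested , consecutive⇒connected (proj₁ ces)) , enlarging e (proj₂ ces)
  where
  ces : ConsecutiveEdges a × 0 < extend a e
  ces = consecutiveEdges-∷ʳ⁻ a (extend a e) (connected⇒consecutive (proj₁ nested) conn)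
  enlarging : ∀ e → 0 < extend a e → e ∈ enlarge ∷ []
  enlarging enlarge _ = here refl

𝒩₂-extensible : IsExtensible 𝒩₂ (isolate ∷ enlarge ∷ [])
𝒩₂-extensible = record
  { unique      = λ n → Unique.filter⁺ is2Nested? (boundedSequences-unique n)
  ; ways-unique = ((λ ()) ∷ []) ∷ [] ∷ []
  ; area        = λ a∈ → proj₁ (∈-𝒩₂⁻ a∈)
  ; extend⁺     = λ {_} {a} {e} a∈ _ → ∈-𝒩₂⁺ (2nested-extend⁺ a e (∈-𝒩₂⁻ a∈))
  ; extend⁻     = λ {_} {a} {e} b∈ → ∈-𝒩₂⁺ (2nested-extend⁻ a e (∈-𝒩₂⁻ b∈)) , every e
  }
  where
  every : ∀ e → e ∈ isolate ∷ enlarge ∷ []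
  every isolate = here refl
  every enlarge = there (here refl)

𝒩₂ᶜ-extensible : IsExtensible 𝒩₂ᶜ (enlarge ∷ [])
𝒩₂ᶜ-extensible = record
  { unique      = λ n → Unique.filter⁺ isConnected2Nested? (boundedSequences-unique n)
  ; ways-unique = [] ∷ []
  ; area        = λ a∈ → proj₁ (proj₁ (∈-𝒩₂ᶜ⁻ a∈))
  ; extend⁺     = λ { {_} {a} a∈ (here refl) → ∈-𝒩₂ᶜ⁺ (connected-extend⁺ a (∈-𝒩₂ᶜ⁻ a∈)) }
  ; extend⁻     = λ {_} {a} {e} b∈ → let p , e∈ = connected-extend⁻ a e (∈-𝒩₂ᶜ⁻ b∈) in
                  ∈-𝒩₂ᶜ⁺ p , e∈
  }

-- Null sequences of rationals

-- Convergence to 0 for bare sequences: no modulus of convergence is required, so it applies to any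
-- termwise expression.
Null : (ℕ → ℚ) → Set
Null f = ∀ ε → 0ℚ ℚ.< ε → ∃ λ N → ∀ n → N ≤ n → ℚ.∣ f n ∣ ℚ.< ε

p-0≡p : ∀ p → p ℚ.- 0ℚ ≡ p
p-0≡p = ℚ.+-identityʳ

≈0⇒null : ∀ {x} → x ≈ℝ 0ℝ → Null (seq x)
≈0⇒null {x} x≈0 ε 0<ε = let N , close = x≈0 ε 0<ε in
  N , λ n N≤n → subst (λ q → ℚ.∣ q ∣ ℚ.< ε) (p-0≡p (seq x n)) (close n N≤n)

null⇒≈0 : ∀ {x} → Null (seq x) → x ≈ℝ 0ℝ
null⇒≈0 {x} null ε 0<ε = let N , close = null ε 0<ε in
  N , λ n N≤n → subst (λ q → ℚ.∣ q ∣ ℚ.< ε) (sym (p-0≡p (seq x n))) (close n N≤n)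

*-pos : ∀ {p q} → 0ℚ ℚ.< p → 0ℚ ℚ.< q → 0ℚ ℚ.< p ℚ.* q
*-pos {p} {q} 0<p 0<q =
  ℚ.positive⁻¹ (p ℚ.* q) ⦃ ℚ.pos*pos⇒pos p ⦃ ℚ.positive 0<p ⦄ q ⦃ ℚ.positive 0<q ⦄ ⦄

*-mono-<-nonNeg : ∀ {p q r s} → 0ℚ ℚ.≤ p → 0ℚ ℚ.< s → p ℚ.< q → r ℚ.< s → p ℚ.* r ℚ.< q ℚ.* s
*-mono-<-nonNeg {p} {q} {r} {s} 0≤p 0<s p<q r<s = ℚ.≤-<-trans
  (ℚ.*-monoˡ-≤-nonNeg p ⦃ ℚ.nonNegative 0≤p ⦄ (ℚ.<⇒≤ r<s))
  (ℚ.*-monoˡ-<-pos s ⦃ ℚ.positive 0<s ⦄ p<q)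

1/pos : ∀ q → 0ℚ ℚ.< q → ∃ λ q⁻¹ → 0ℚ ℚ.< q⁻¹ × q ℚ.* q⁻¹ ≡ 1ℚ
1/pos q 0<q = ℚ.1/ q , ℚ.positive⁻¹ (ℚ.1/ q) ⦃ ℚ.1/pos⇒pos q ⦄ , ℚ.*-inverseʳ q
  where
  instance
    q⁺ : ℚ.Positive q
    q⁺ = ℚ.positive 0<q
    q≢0 : ℚ.NonZero q
    q≢0 = ℚ.pos⇒nonZero q

null-+ : ∀ {f g} → Null f → Null g → Null (λ n → f n ℚ.+ g n)
null-+ {f} {g} f→0 g→0 ε 0<ε =
  let N , f< = f→0 (½ ℚ.* ε) 0<½ε
      M , g< = g→0 (½ ℚ.* ε) 0<½ε
  in N ℕ.⊔ M , λ n le → ℚ.≤-<-trans (ℚ.∣p+q∣≤∣p∣+∣q∣ (f n) (g n))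
    (subst (_ ℚ.<_) (trans (sym (ℚ.*-distribʳ-+ ε ½ ½)) (ℚ.*-identityˡ ε))
      (ℚ.+-mono-< (f< n (ℕ.m⊔n≤o⇒m≤o N M le)) (g< n (ℕ.m⊔n≤o⇒n≤o N M le))))
  where
  0<½ε : 0ℚ ℚ.< ½ ℚ.* ε
  0<½ε = *-pos (ℚ.positive⁻¹ ½) 0<ε

eventuallyBounded : ∀ x → ∃ λ B → 0ℚ ℚ.< B × ∃ λ N → ∀ n → N ≤ n → ℚ.∣ seq x n ∣ ℚ.< B
eventuallyBounded x =
  let N , close = cauchy x 1ℚ (ℚ.positive⁻¹ 1ℚ) in
    1ℚ ℚ.+ ℚ.∣ seq x N ∣
  , ℚ.+-mono-<-≤ (ℚ.positive⁻¹ 1ℚ) (ℚ.0≤∣p∣ (seq x N))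
  , N , λ n N≤n → subst (λ q → ℚ.∣ q ∣ ℚ.< 1ℚ ℚ.+ ℚ.∣ seq x N ∣)
      (solve 2 (λ p q → p :- q :+ q := p) refl (seq x n) (seq x N))
      (ℚ.≤-<-trans (ℚ.∣p+q∣≤∣p∣+∣q∣ (seq x n ℚ.- seq x N) (seq x N))
        (ℚ.+-mono-<-≤ (close n N N≤n ℕ.≤-refl) ℚ.≤-refl))

null-* : ∀ x {f} → Null f → Null (λ n → seq x n ℚ.* f n)
null-* x {f} f→0 ε 0<ε =
  let B , 0<B , M , x< = eventuallyBounded x
      B⁻¹ , 0<B⁻¹ , BB⁻¹≡1 = 1/pos B 0<B
      N , f< = f→0 (B⁻¹ ℚ.* ε) (*-pos 0<B⁻¹ 0<ε)
  in M ℕ.⊔ N , λ n le → subst₂ ℚ._<_ (sym (ℚ.∣p*q∣≡∣p∣*∣q∣ (seq x n) (f n)))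
    (trans (sym (ℚ.*-assoc B B⁻¹ ε)) (trans (cong (ℚ._* ε) BB⁻¹≡1) (ℚ.*-identityˡ ε)))
    (*-mono-<-nonNeg (ℚ.0≤∣p∣ (seq x n)) (*-pos 0<B⁻¹ 0<ε)
      (x< n (ℕ.m⊔n≤o⇒m≤o M N le)) (f< n (ℕ.m⊔n≤o⇒n≤o M N le)))

p≤∣p∣ : ∀ p → p ℚ.≤ ℚ.∣ p ∣
p≤∣p∣ p with ℚ.∣p∣≡p∨∣p∣≡-p p
... | inj₁ eq = ℚ.≤-reflexive (sym eq)
... | inj₂ eq = ℚ.≤-trans
  (subst (ℚ._≤ 0ℚ) (solve 1 (λ q → :- (:- q) := q) refl p)
    (ℚ.neg-antimono-≤ (subst (0ℚ ℚ.≤_) eq (ℚ.0≤∣p∣ p))))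
  (ℚ.0≤∣p∣ p)

∣p∣²≡p² : ∀ p → ℚ.∣ p ∣ ℚ.* ℚ.∣ p ∣ ≡ p ℚ.* p
∣p∣²≡p² p with ℚ.∣p∣≡p∨∣p∣≡-p p
... | inj₁ eq = cong₂ ℚ._*_ eq eq
... | inj₂ eq = trans (cong₂ ℚ._*_ eq eq) (solve 1 (λ q → :- q :* :- q := q :* q) refl p)

0≤p² : ∀ p → 0ℚ ℚ.≤ p ℚ.* p
0≤p² p = subst (0ℚ ℚ.≤_) (∣p∣²≡p² p)
  (subst (ℚ._≤ ℚ.∣ p ∣ ℚ.* ℚ.∣ p ∣) (ℚ.*-zeroʳ ℚ.∣ p ∣)
    (ℚ.*-monoˡ-≤-nonNeg ℚ.∣ p ∣ ⦃ ℚ.∣-∣-nonNeg p ⦄ (ℚ.0≤∣p∣ p)))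

-- If `∣ f n ∣` were at least ε, then ε² ≤ f(n)² ≤ g(n) < ε². Hence `g` is queried at tolerance ε².
null-√ : ∀ {f g} → Null g → (∀ n → f n ℚ.* f n ℚ.≤ g n) → Null f
null-√ {f} {g} g→0 f²≤g ε 0<ε =
  let N , g< = g→0 (ε ℚ.* ε) (*-pos 0<ε 0<ε) in
  N , λ n N≤n → ℚ.≰⇒> λ ε≤∣f∣ → ℚ.<-irrefl refl (ℚ.<-≤-trans (g< n N≤n) (begin
    ε ℚ.* ε                   ≤⟨ ℚ.*-monoˡ-≤-nonNeg ε ⦃ ℚ.nonNegative (ℚ.<⇒≤ 0<ε) ⦄ ε≤∣f∣ ⟩
    ε ℚ.* ℚ.∣ f n ∣           ≤⟨ ℚ.*-monoʳ-≤-nonNeg ℚ.∣ f n ∣ ⦃ ℚ.∣-∣-nonNeg (f n) ⦄ ε≤∣f∣ ⟩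
    ℚ.∣ f n ∣ ℚ.* ℚ.∣ f n ∣   ≡⟨ ∣p∣²≡p² (f n) ⟩
    f n ℚ.* f n               ≤⟨ f²≤g n ⟩
    g n                       ≤⟨ p≤∣p∣ (g n) ⟩
    ℚ.∣ g n ∣                 ∎))
  where open ℚ.≤-Reasoning

null-cancel : ∀ {c f} → 0ℚ ℚ.< c → Null (λ n → c ℚ.* f n) → Null f
null-cancel {c} {f} 0<c cf→0 ε 0<ε =
  let N , cf< = cf→0 (c ℚ.* ε) (*-pos 0<c 0<ε) in
  N , λ n N≤n → ℚ.*-cancelˡ-<-nonNeg c ⦃ ℚ.nonNegative (ℚ.<⇒≤ 0<c) ⦄
    (subst (ℚ._< c ℚ.* ε)
      (trans (ℚ.∣p*q∣≡∣p∣*∣q∣ c (f n))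
        (cong (ℚ._* ℚ.∣ f n ∣) (ℚ.0≤p⇒∣p∣≡p (ℚ.<⇒≤ 0<c))))
      (cf< n N≤n))

pointwise⇒≈ : ∀ {x y} → (∀ n → seq x n ≡ seq y n) → x ≈ℝ y
pointwise⇒≈ {x} {y} eq ε 0<ε = 0 , λ n _ →
  subst (λ q → ℚ.∣ q ∣ ℚ.< ε)
    (sym (trans (cong (ℚ._- seq y n) (eq n)) (ℚ.+-inverseʳ (seq y n)))) 0<ε

fromℚ-mono : ∀ {p q} → p ℚ.≤ q → fromℚ p ≤ℝ fromℚ q
fromℚ-mono {p} {q} p≤q ε 0<ε = 0 , λ _ _ → ℚ.≤-trans p≤q
  (subst (ℚ._≤ q ℚ.+ ε) (ℚ.+-identityʳ q) (ℚ.+-monoʳ-≤ q (ℚ.<⇒≤ 0<ε)))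

pos⇒0<ℝ : ∀ {x q} → 0ℚ ℚ.< q → (∀ n → seq x n ≡ q) → 0ℝ <ℝ x
pos⇒0<ℝ {q = q} 0<q eq = q , 0<q , 0 , λ n _ →
  ℚ.≤-reflexive (trans (ℚ.+-identityˡ q) (sym (eq n)))

-- Natural numbers in ℚ

ι : ℕ → ℚ
ι n = n · 1ℚ

0≤ι : ∀ n → 0ℚ ℚ.≤ ι n
0≤ι zero    = ℚ.≤-refl
0≤ι (suc n) = ℚ.+-mono-≤ (ℚ.nonNegative⁻¹ 1ℚ) (0≤ι n)

0<ι : ∀ n → 0ℚ ℚ.< ι (suc n)
0<ι n = ℚ.+-mono-<-≤ (ℚ.positive⁻¹ 1ℚ) (0≤ι n)

ι-mono : ∀ {m n} → m ≤ n → ι m ℚ.≤ ι n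
ι-mono {n = n} z≤n = 0≤ι n
ι-mono (s≤s m≤n)   = ℚ.+-monoʳ-≤ 1ℚ (ι-mono m≤n)

-- The polynomials a t + b t²

quadratic : ℕ → ℕ → ℕ → ℚ
quadratic a b 1 = ι a
quadratic a b 2 = ι b
quadratic a b _ = 0ℚ

-- Equality at every index rather than up to `_≈ℝ_`: the coefficients are constant sequences, so
-- evaluations reduce to ring identities in ℚ at a fixed index.
IsQuadratic : Poly → ℕ → ℕ → Set
IsQuadratic p a b = ∀ k n → seq (coeff p k) n ≡ quadratic a b k

tail : Poly → Poly
tail []      = []
tail (_ ∷ p) = p

coeff-tail : ∀ p k → coeff (tail p) k ≡ coeff p (suc k)
coeff-tail []      k = refl
coeff-tail (_ ∷ p) k = refl

module _ (z : ℂ) (n : ℕ) where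
  private
    x = seq (re z) n
    y = seq (im z) n

  EvalsTo : Poly → ℚ → ℚ → Set
  EvalsTo p u v = seq (re (evalℂ p z)) n ≡ u × seq (im (evalℂ p z)) n ≡ v

  -- One Horner step, valid also for the empty list: the number of stored coefficients is not known,
  -- only their values are.
  eval-uncons : ∀ p {c u v} → seq (coeff p 0) n ≡ c → EvalsTo (tail p) u v →
                EvalsTo p (c ℚ.+ (x ℚ.* u ℚ.- y ℚ.* v)) (x ℚ.* v ℚ.+ y ℚ.* u)
  eval-uncons []      refl (refl , refl) =
      solve 2 (λ x y → con 0ℚ := con 0ℚ :+ (x :* con 0ℚ :- y :* con 0ℚ)) refl x y
    , solve 2 (λ x y → con 0ℚ := x :* con 0ℚ :+ y :* con 0ℚ) refl x y
  eval-uncons (c ∷ p) refl (refl , refl) = refl , ℚ.+-identityˡ _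

  eval-zero : ∀ p → (∀ k → seq (coeff p k) n ≡ 0ℚ) → EvalsTo p 0ℚ 0ℚ
  eval-zero []      _  = refl , refl
  eval-zero (c ∷ p) ≡0 =
    let re≡ , im≡ = eval-uncons (c ∷ p) (≡0 0) (eval-zero p λ k → ≡0 (suc k)) in
      trans re≡ (solve 2 (λ x y → con 0ℚ :+ (x :* con 0ℚ :- y :* con 0ℚ) := con 0ℚ) refl x y)
    , trans im≡ (solve 2 (λ x y → x :* con 0ℚ :+ y :* con 0ℚ := con 0ℚ) refl x y)

  -- The real and imaginary parts of a z + b z² at z = x + i y. Three Horner steps expose the
  -- coefficients 0, a, b, and the remaining tail evaluates to 0.
  eval-quadratic : ∀ p {a b} → IsQuadratic p a b →
                   EvalsTo p (ι a ℚ.* x ℚ.+ ι b ℚ.* (x ℚ.* x ℚ.- y ℚ.* y))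
                             (y ℚ.* (ι a ℚ.+ (ι b ℚ.+ ι b) ℚ.* x))
  eval-quadratic p {a} {b} quad =
    let p₁ = tail p
        p₂ = tail p₁
        p₃ = tail p₂
        c₁ k = coeff-tail p k
        c₂ k = trans (coeff-tail p₁ k) (c₁ (suc k))
        c₃ k = trans (coeff-tail p₂ k) (c₂ (suc k))
        at {k} {c} c≡ = trans (cong (λ r → seq r n) {c} {coeff p k} c≡) (quad k n)
        re≡ , im≡ = eval-uncons p (quad 0 n) (eval-uncons p₁ (at {1} (c₁ 0))
                      (eval-uncons p₂ (at {2} (c₂ 0)) (eval-zero p₃ λ k → at {suc (suc (suc k))} (c₃ k))))
    in trans re≡ (solve 4 (λ a b x y →
         let u = b :+ (x :* con 0ℚ :- y :* con 0ℚ)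
             v = x :* con 0ℚ :+ y :* con 0ℚ
             u′ = a :+ (x :* u :- y :* v)
             v′ = x :* v :+ y :* u
         in con 0ℚ :+ (x :* u′ :- y :* v′) := a :* x :+ b :* (x :* x :- y :* y))
         refl (ι a) (ι b) x y)
     , trans im≡ (solve 4 (λ a b x y →
         let u = b :+ (x :* con 0ℚ :- y :* con 0ℚ)
             v = x :* con 0ℚ :+ y :* con 0ℚ
             u′ = a :+ (x :* u :- y :* v)
             v′ = x :* v :+ y :* u
         in x :* v′ :+ y :* u′ := y :* (a :+ (b :+ b) :* x))
         refl (ι a) (ι b) x y)

-- With z = x + iy, the identity (Im p(z))² − 4 b y² Re p(z) = (a y)² + (2 b y²)²
-- bounds (a y)² by a null sequence.

quadratic-realRooted : ∀ p a b → IsQuadratic p (suc a) b → IsRealRooted p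
quadratic-realRooted p a′ b′ quad = inj₂ λ z (re≈0 , im≈0) →
  null⇒≈0 {im z} (null-cancel (0<ι a′) (null-√
    (null-+ (null-* (im (evalℂ p z)) (≈0⇒null {im (evalℂ p z)} im≈0))
            (null-* (fromℚ (ℚ.- (b ℚ.+ b ℚ.+ b ℚ.+ b)) *ℝ (im z *ℝ im z))
                    (≈0⇒null {re (evalℂ p z)} re≈0)))
    λ n → let x = seq (re z) n ; y = seq (im z) n
              re≡ , im≡ = eval-quadratic z n p quad
              w = (b ℚ.+ b) ℚ.* (y ℚ.* y) in
      subst₂ ℚ._≤_ (ℚ.+-identityʳ _)
        (trans (solve 4 (λ a b x y →
                  let im = y :* (a :+ (b :+ b) :* x)
                      re = a :* x :+ b :* (x :* x :- y :* y)
                      w = (b :+ b) :* (y :* y)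
                  in a :* y :* (a :* y) :+ w :* w
                     := im :* im :+ :- (b :+ b :+ b :+ b) :* (y :* y) :* re)
                refl a b x y)
          (sym (cong₂ (λ i r → i ℚ.* i ℚ.+ ℚ.- (b ℚ.+ b ℚ.+ b ℚ.+ b) ℚ.* (y ℚ.* y) ℚ.* r) im≡ re≡)))
        (ℚ.+-monoʳ-≤ (a ℚ.* y ℚ.* (a ℚ.* y)) (0≤p² w))))
  where
  a = ι (suc a′)
  b = ι b′

quadratic-leading : ∀ p a b → IsQuadratic p (suc a) b → HasPositiveLeadingCoeff p
quadratic-leading p a zero    quad =
  1 , pos⇒0<ℝ {coeff p 1} (0<ι a) (quad 1)
    , λ { 0 () ; 1 (s≤s ())
        ; 2 _ → pointwise⇒≈ {coeff p 2} {0ℝ} (quad 2)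
        ; k@(suc (suc (suc _))) _ → pointwise⇒≈ {coeff p k} {0ℝ} (quad k) }
quadratic-leading p a (suc b) quad =
  2 , pos⇒0<ℝ {coeff p 2} (0<ι b) (quad 2)
    , λ { 0 () ; 1 (s≤s ()) ; 2 (s≤s (s≤s ()))
        ; k@(suc (suc (suc _))) _ → pointwise⇒≈ {coeff p k} {0ℝ} (quad k) }

-- Zeros and interlacing of a t + b t²

fromRoots : List ℝ → Poly
fromRoots = foldr (λ r q → ((-ℝ r) ∷ 1ℝ ∷ []) *ₚ q) 1ₚ

linear-zeros : ∀ p a → IsQuadratic p (suc a) 0 → HasZeros p (0ℝ ∷ [])
linear-zeros p a quad = fromℚ c , pos⇒0<ℝ {fromℚ c} (0<ι a) (λ _ → refl) , coeffs
  where
  c = ι (suc a)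
  q = fromℚ c ·ₚ fromRoots (0ℝ ∷ [])
  coeffs : p ≈ₚ q
  coeffs 0 = pointwise⇒≈ {coeff p 0} {coeff q 0} λ n → trans (quad 0 n) (sym (ℚ.*-zeroʳ c))
  coeffs 1 = pointwise⇒≈ {coeff p 1} {coeff q 1} λ n → trans (quad 1 n) (sym (ℚ.*-identityʳ c))
  coeffs 2 = pointwise⇒≈ {coeff p 2} {coeff q 2} (quad 2)
  coeffs k@(suc (suc (suc _))) = pointwise⇒≈ {coeff p k} {coeff q k} (quad k)

-- With c = ι (b + 1), the product c t (t - r) has linear coefficient - c r. The equation on `r`
-- says r = - a / (b + 1) without a division.
quadratic-zeros : ∀ p a b r → IsQuadratic p a (suc b) → ι a ≡ ℚ.- (ι (suc b) ℚ.* r) →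
                  HasZeros p (0ℝ ∷ fromℚ r ∷ [])
quadratic-zeros p a b r quad root = fromℚ c , pos⇒0<ℝ {fromℚ c} (0<ι b) (λ _ → refl) , coeffs
  where
  c = ι (suc b)
  q = fromℚ c ·ₚ fromRoots (0ℝ ∷ fromℚ r ∷ [])
  coeffs : p ≈ₚ q
  coeffs 0 = pointwise⇒≈ {coeff p 0} {coeff q 0} λ n → trans (quad 0 n)
    (solve 2 (λ c r → con 0ℚ := c :* (con 0ℚ :* (:- r :* con 1ℚ :+ con 0ℚ) :+ con 0ℚ)) refl c r)
  coeffs 1 = pointwise⇒≈ {coeff p 1} {coeff q 1} λ n → trans (quad 1 n) (trans root
    (solve 2 (λ c r → :- (c :* r) := c :* (con 0ℚ :+ (con 1ℚ :* (:- r :* con 1ℚ :+ con 0ℚ) :+ con 0ℚ))) refl c r))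
  coeffs 2 = pointwise⇒≈ {coeff p 2} {coeff q 2} λ n → trans (quad 2 n) (sym (ℚ.*-identityʳ c))
  coeffs k@(suc (suc (suc _))) = pointwise⇒≈ {coeff p k} {coeff q k} (quad k)

nonzeroRoot : ∀ a b → ∃ λ r → ι a ≡ ℚ.- (ι (suc b) ℚ.* r)
nonzeroRoot a b = let b⁻¹ , _ , bb⁻¹≡1 = 1/pos (ι (suc b)) (0<ι b) in
  ℚ.- (b⁻¹ ℚ.* ι a) ,
  sym (trans (solve 3 (λ b c a → :- (b :* :- (c :* a)) := b :* c :* a) refl (ι (suc b)) b⁻¹ (ι a))
    (trans (cong (ℚ._* ι a) bb⁻¹≡1) (ℚ.*-identityˡ (ι a))))

-- Cross-multiplication: scaled by the positive number c c′, the two roots become - a c′ and - a′ c.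
nonzeroRoot-≤ : ∀ {a b a′ b′ r r′} →
  ι a ≡ ℚ.- (ι (suc b) ℚ.* r) → ι a′ ≡ ℚ.- (ι (suc b′) ℚ.* r′) →
  a′ ℕ.* suc b ≤ a ℕ.* suc b′ → r ℚ.≤ r′
nonzeroRoot-≤ {a} {b} {a′} {b′} {r} {r′} root root′ le =
  ℚ.*-cancelˡ-≤-pos (c ℚ.* c′) ⦃ ℚ.positive (*-pos (0<ι b) (0<ι b′)) ⦄
    (subst₂ ℚ._≤_
      (solve 3 (λ c c′ r → :- (:- (c :* r) :* c′) := c :* c′ :* r) refl c c′ r)
      (solve 3 (λ c c′ r′ → :- (:- (c′ :* r′) :* c) := c :* c′ :* r′) refl c c′ r′)
      (ℚ.neg-antimono-≤ (subst₂ ℚ._≤_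
        (trans (×1-homo-* a′ (suc b)) (cong (ℚ._* c) root′))
        (trans (×1-homo-* a (suc b′)) (cong (ℚ._* c′) root))
        (ι-mono le))))
  where
  c = ι (suc b)
  c′ = ι (suc b′)

nonzeroRoot≤0 : ∀ {a b r} → ι a ≡ ℚ.- (ι (suc b) ℚ.* r) → r ℚ.≤ 0ℚ
-- Comparison with the polynomial 0 t + 1 t², whose second root is 0.
nonzeroRoot≤0 {a} {b} root = nonzeroRoot-≤ {a} {b} {0} {0} {r′ = 0ℚ} root refl z≤n

-- When both degrees are 2, the interlaced list is 0, 0, r′, r, so beyond the sign of r′ only r ≤ r′
-- is at stake. The degree cannot drop, since the hypothesis would then bound a positive product by
-- 0.
quadratic-≪ : ∀ p q a b a′ b′ → IsQuadratic p (suc a) b → IsQuadratic q (suc a′) b′ →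
              suc a′ ℕ.* b ≤ suc a ℕ.* b′ → p ≪ q
quadratic-≪ p q a zero a′ zero quad quad′ _ = inj₂ (inj₂
  ( 0ℝ ∷ [] , 0ℝ ∷ [] , linear-zeros p a quad , linear-zeros q a′ quad′
  , s≤s z≤n , s≤s z≤n , fromℚ-mono ℚ.≤-refl ∷ [-]))
quadratic-≪ p q a zero a′ (suc b′) quad quad′ _ =
  let r , root = nonzeroRoot (suc a′) b′ in inj₂ (inj₂
  ( 0ℝ ∷ [] , 0ℝ ∷ fromℚ r ∷ [] , linear-zeros p a quad , quadratic-zeros q (suc a′) b′ r quad′ root
  , s≤s z≤n , s≤s (s≤s z≤n)
  , fromℚ-mono ℚ.≤-refl ∷ fromℚ-mono (nonzeroRoot≤0 {suc a′} {b′} root) ∷ [-]))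
quadratic-≪ p q a (suc b) a′ zero quad quad′ le =
  contradiction (subst (suc a′ ℕ.* suc b ≤_) (ℕ.*-zeroʳ (suc a)) le) λ ()
quadratic-≪ p q a (suc b) a′ (suc b′) quad quad′ le =
  let r  , root  = nonzeroRoot (suc a) b
      r′ , root′ = nonzeroRoot (suc a′) b′ in inj₂ (inj₂
  ( 0ℝ ∷ fromℚ r ∷ [] , 0ℝ ∷ fromℚ r′ ∷ []
  , quadratic-zeros p (suc a) b r quad root , quadratic-zeros q (suc a′) b′ r′ quad′ root′
  , s≤s (s≤s z≤n) , s≤s (s≤s z≤n)
  , fromℚ-mono ℚ.≤-refl
    ∷ fromℚ-mono (nonzeroRoot≤0 {suc a′} {b′} root′)
    ∷ fromℚ-mono (nonzeroRoot-≤ {suc a} {b} {suc a′} {b′} root root′ le) ∷ [-]))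

-- Coefficients of a sum of powers of t

coeff-+ₚ : ∀ p q k n → seq (coeff (p +ₚ q) k) n ≡ seq (coeff p k) n ℚ.+ seq (coeff q k) n
coeff-+ₚ []      q       k       n = sym (ℚ.+-identityˡ _)
coeff-+ₚ (c ∷ p) []      k       n = sym (ℚ.+-identityʳ _)
coeff-+ₚ (c ∷ p) (d ∷ q) zero    n = refl
coeff-+ₚ (c ∷ p) (d ∷ q) (suc k) n = coeff-+ₚ p q k n

coeff-t^-≡ : ∀ k n → seq (coeff (t^ k) k) n ≡ 1ℚ
coeff-t^-≡ zero    n = refl
coeff-t^-≡ (suc k) n = coeff-t^-≡ k n

coeff-t^-≢ : ∀ j k n → j ≢ k → seq (coeff (t^ j) k) n ≡ 0ℚ
coeff-t^-≢ zero    zero    n j≢k = contradiction refl j≢k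
coeff-t^-≢ zero    (suc k) n j≢k = refl
coeff-t^-≢ (suc j) zero    n j≢k = refl
coeff-t^-≢ (suc j) (suc k) n j≢k = coeff-t^-≢ j k n λ j≡k → j≢k (cong suc j≡k)

coeff-sum-t^ : ∀ {A : Set} (f : A → ℕ) xs k n →
  seq (coeff (sumₚ (map (λ x → t^ (f x)) xs)) k) n ≡ ι (length (filter (λ x → f x ℕ.≟ k) xs))
coeff-sum-t^ f []       k n = refl
coeff-sum-t^ f (x ∷ xs) k n = trans (coeff-+ₚ (t^ (f x)) _ k n)
  (trans (cong (seq (coeff (t^ (f x)) k) n ℚ.+_) (coeff-sum-t^ f xs k n)) (count (f x ℕ.≟ k)))
  where
  _≟k : ∀ y → Dec (f y ≡ k)
  y ≟k = f y ℕ.≟ k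
  count : Dec (f x ≡ k) → seq (coeff (t^ (f x)) k) n ℚ.+ ι (length (filter _≟k xs))
                          ≡ ι (length (filter _≟k (x ∷ xs)))
  count (yes fx≡k) = trans
    (cong (ℚ._+ ι (length (filter _≟k xs)))
      (subst (λ j → seq (coeff (t^ j) k) n ≡ 1ℚ) (sym fx≡k) (coeff-t^-≡ k n)))
    (cong (λ l → ι (length l)) (sym (filter-accept _≟k fx≡k)))
  count (no fx≢k) = trans
    (cong (ℚ._+ ι (length (filter _≟k xs))) (coeff-t^-≢ (f x) k n fx≢k))
    (trans (ℚ.+-identityˡ _) (cong (λ l → ι (length l)) (sym (filter-reject _≟k fx≢k))))

sum-t^-quadratic : ∀ {A : Set} (f : A → ℕ) xs → All (λ x → 1 ≤ f x × f x ≤ 2) xs →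
  IsQuadratic (sumₚ (map (λ x → t^ (f x)) xs))
    (length (filter (λ x → f x ℕ.≟ 1) xs)) (length (filter (λ x → f x ℕ.≟ 2) xs))
sum-t^-quadratic f xs range 0 n = trans (coeff-sum-t^ f xs 0 n)
  (cong (λ l → ι (length l)) (filter-none _
    (All.map (λ (1≤ , _) ≡0 → contradiction (subst (1 ≤_) ≡0 1≤) λ ()) range)))
sum-t^-quadratic f xs range 1 n = coeff-sum-t^ f xs 1 n
sum-t^-quadratic f xs range 2 n = coeff-sum-t^ f xs 2 n
sum-t^-quadratic f xs range k@(suc (suc (suc _))) n = trans (coeff-sum-t^ f xs k n)
  (cong (λ l → ι (length l)) (filter-none _
    (All.map (λ (_ , ≤2) ≡k → contradiction (subst (_≤ 2) ≡k ≤2) λ { (s≤s (s≤s ())) }) range)))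

-- From extensible families to Sturm sequences

1ₚ-≪-linear : ∀ p a → IsQuadratic p (suc a) 0 → 1ₚ ≪ p
1ₚ-≪-linear p a quad = inj₂ (inj₂
  ( [] , 0ℝ ∷ []
  , (1ℝ , pos⇒0<ℝ {1ℝ} (ℚ.positive⁻¹ 1ℚ) (λ _ → refl)
        , λ { zero    → pointwise⇒≈ {1ℝ} {1ℝ *ℝ 1ℝ} λ _ → refl
            ; (suc k) → pointwise⇒≈ {0ℝ} {0ℝ} λ _ → refl })
  , linear-zeros p a quad , z≤n , s≤s z≤n , [-]))

module Family {𝓕 ways} (𝓕-extensible : IsExtensible 𝓕 ways)
  (2nested : ∀ {n a} → a ∈ 𝓕 n → pnest a ≤ 2)
  (0<ways : 0 < length ways)
  (0<count₁ : 0 < Recurrence.count 𝓕-extensible 1 1) where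

  open IsExtensible 𝓕-extensible using (area)
  open Recurrence 𝓕-extensible

  poly : ℕ → Poly
  poly n = sumₚ (map (λ a → t^ (pnest a)) (𝓕 n))

  -- A nonzero linear coefficient keeps every polynomial nonzero and is the factor cancelled in the
  -- bound on the imaginary part.
  count₁-pos : ∀ n → 0 < count 1 (suc n)
  count₁-pos zero    = 0<count₁
  count₁-pos (suc n) = ℕ.<-≤-trans (ℕ.*-mono-< (count₁-pos n) 0<ways) (count-≥ 1 n)

  count₁-suc : ∀ n → count 1 (suc n) ≡ suc (ℕ.pred (count 1 (suc n)))
  count₁-suc n = sym (ℕ.suc-pred (count 1 (suc n)) ⦃ ℕ.>-nonZero (count₁-pos n) ⦄)

  poly-quadratic : ∀ n → IsQuadratic (poly (suc n)) (suc (ℕ.pred (count 1 (suc n)))) (count 2 (suc n))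
  poly-quadratic n = subst (λ k → IsQuadratic (poly (suc n)) k (count 2 (suc n))) (count₁-suc n)
    (sum-t^-quadratic pnest (𝓕 (suc n)) (All.tabulate λ a∈ → pnest≥1 (area a∈) , 2nested a∈))

  ratio-mono : ∀ n → count 1 (suc (suc n)) ℕ.* count 2 (suc n)
                   ≤ count 1 (suc n) ℕ.* count 2 (suc (suc n))
  ratio-mono n = begin
    count 1 (suc (suc n)) ℕ.* c₂           ≤⟨ ℕ.*-monoˡ-≤ c₂ (count₁-≤ n) ⟩
    c₁ ℕ.* length ways ℕ.* c₂              ≡⟨ ℕ.*-assoc c₁ (length ways) c₂ ⟩
    c₁ ℕ.* (length ways ℕ.* c₂)            ≡⟨ cong (c₁ ℕ.*_) (ℕ.*-comm (length ways) c₂) ⟩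
    c₁ ℕ.* (c₂ ℕ.* length ways)            ≤⟨ ℕ.*-monoʳ-≤ c₁ (count-≥ 2 n) ⟩
    c₁ ℕ.* count 2 (suc (suc n))           ∎
    where
    open ℕ.≤-Reasoning
    c₁ = count 1 (suc n)
    c₂ = count 2 (suc n)

  poly-realRooted : ∀ n → IsRealRooted (poly (suc n))
  poly-realRooted n = quadratic-realRooted (poly (suc n)) _ _ (poly-quadratic n)

  poly-leading : ∀ n → HasPositiveLeadingCoeff (poly (suc n))
  poly-leading n = quadratic-leading (poly (suc n)) _ _ (poly-quadratic n)

  poly-≪ : ∀ n → poly (suc n) ≪ poly (suc (suc n))
  poly-≪ n = quadratic-≪ (poly (suc n)) (poly (suc (suc n))) _ _ _ _
    (poly-quadratic n) (poly-quadratic (suc n))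
    (subst₂ (λ c c′ → c′ ℕ.* count 2 (suc n) ≤ c ℕ.* count 2 (suc (suc n)))
      (count₁-suc n) (count₁-suc (suc n)) (ratio-mono n))

-- The last argument holds by evaluation, for both families: the only sequence of size 1 is
-- connected and has peak-nesting 1.
module All₂ = Family 𝒩₂-extensible (λ a∈ → proj₂ (∈-𝒩₂⁻ a∈)) (s≤s z≤n) (s≤s z≤n)
module Connected₂ =
  Family 𝒩₂ᶜ-extensible (λ a∈ → proj₂ (proj₁ (∈-𝒩₂ᶜ⁻ a∈))) (s≤s z≤n) (s≤s z≤n)

corollary5p5 : ((n : ℕ) → IsRealRooted (Pnest𝒩₂ n) × IsRealRooted (Pnestᶜ𝒩₂ n))
    × IsGeneralizedSturm Pnest𝒩₂
    × IsGeneralizedSturm Pnestᶜ𝒩₂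
corollary5p5 =
    (λ n → realRooted n , realRootedᶜ n)
  , ((λ n → realRooted n , inj₂ (leading n)) , sturm)
  , ((λ n → realRootedᶜ n , leadingᶜ n) , sturmᶜ)
  where
  realRooted : ∀ n → IsRealRooted (Pnest𝒩₂ n)
  realRooted zero    = inj₁ λ { (suc k) _ → pointwise⇒≈ {0ℝ} {0ℝ} λ _ → refl }
  realRooted (suc n) = All₂.poly-realRooted n

  realRootedᶜ : ∀ n → IsRealRooted (Pnestᶜ𝒩₂ n)
  realRootedᶜ zero    = inj₁ λ _ _ → pointwise⇒≈ {0ℝ} {0ℝ} λ _ → refl
  realRootedᶜ (suc n) = Connected₂.poly-realRooted n

  leading : ∀ n → HasPositiveLeadingCoeff (Pnest𝒩₂ n)
  leading zero    = 0 , pos⇒0<ℝ {1ℝ} (ℚ.positive⁻¹ 1ℚ) (λ _ → refl)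
                      , λ { (suc k) _ → pointwise⇒≈ {0ℝ} {0ℝ} λ _ → refl }
  leading (suc n) = All₂.poly-leading n

  leadingᶜ : ∀ n → Pnestᶜ𝒩₂ n ≈ₚ 0ₚ ⊎ HasPositiveLeadingCoeff (Pnestᶜ𝒩₂ n)
  leadingᶜ zero    = inj₁ λ _ → pointwise⇒≈ {0ℝ} {0ℝ} λ _ → refl
  leadingᶜ (suc n) = inj₂ (Connected₂.poly-leading n)

  sturm : ∀ n → Pnest𝒩₂ n ≪ Pnest𝒩₂ (suc n)
  -- At size 1 the counts for nesting 1 and 2 evaluate to 1 and 0, so the polynomial is t.
  sturm zero    = 1ₚ-≪-linear (Pnest𝒩₂ 1) 0 (All₂.poly-quadratic 0)
  sturm (suc n) = All₂.poly-≪ n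

  sturmᶜ : ∀ n → Pnestᶜ𝒩₂ n ≪ Pnestᶜ𝒩₂ (suc n)
  sturmᶜ zero    = inj₁ λ _ → pointwise⇒≈ {0ℝ} {0ℝ} λ _ → refl
  sturmᶜ (suc n) = Connected₂.poly-≪ n
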